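{- For every $\varepsilon>0$, there is no (possibly randomized) greedy OCRS for the single-item setting that, on every finite ground set $N$, for every $x\in[0,1]^N$ with $\sum_{i\in N}x_i\le 1$, and for every $i\in N$ with $x_i>0$, selects $i$, conditioned on $i$ being active, with probability at least $\frac{1}{e}+\varepsilon$ against every almighty adversary choosing the arrival order.
   Context: Single-item setting: given a finite ground set $N$, the feasible sets are $\mathcal{F}=\{S\subseteq N : |S|\le 1\}$, with relaxation $\mathcal{P}=\{x\in[0,1]^N : \sum_{i\in N} x_i\le 1\}$. For $x\in\mathcal{P}$, $R(x)\subseteq N$ is the random set of active elements, in which each $i\in N$ appears independently with probability $x_i$. Elements arrive one by one, revealing whether they are active, and an online contention resolution scheme (OCRS) must immediately and irrevocably decide whether to select each active element, keeping the selected set in $\mathcal{F}$. A greedy OCRS specifies, for each $N$ and each $x\in\mathcal{P}$, a down-closed family $\mathcal{F}_x\subseteq\mathcal{F}$ before the online process starts, and then selects an arriving active element whenever it, together with the elements already selected, forms a set in $\mathcal{F}_x$. It is randomized if, given $x$, the choice of $\mathcal{F}_x$ is random (drawn independently of $R(x)$, and not depending on the arrival order). An almighty adversary chooses the arrival order of the elements with full knowledge of the realizations of both $R(x)$ and the random choices of the algorithm (in particular $\mathcal{F}_x$). -}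

module Defs where

open import Data.Bool using (Bool; true; false; if_then_else_; _∧_; T)
open import Data.Fin using (Fin; zero; suc)
open import Data.Fin.Permutation using (Permutation′; _⟨$⟩ʳ_)
open import Data.Fin.Subset using (Subset; inside; outside; ⊥; ⁅_⁆; _∪_; _⊆_; ∣_∣)
open import Data.Integer as ℤ using (+_; +[1+_])
import Data.Integer.Properties as ℤₚ
open import Data.List using (List; map; foldl; allFin)
open import Data.Nat as ℕ using (ℕ; zero; suc; _!)
import Data.Nat.Properties as ℕₚ
open import Data.Product using (Σ; ∃; ∃-syntax; _×_; _,_; proj₁; proj₂)
open import Data.Rational as ℚ using (ℚ; mkℚ; 0ℚ; 1ℚ; ½)
import Data.Rational.Properties as ℚₚ
open import Data.Rational.Solver using (module +-*-Solver)
import Data.Rational.Unnormalised as ℚᵘ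
import Data.Rational.Unnormalised.Properties as ℚᵘₚ
open import Data.Sum using (inj₁; inj₂)
open import Data.Vec using ([]; _∷_; lookup)
import Data.Vec.Functional as Vector
open import Relation.Binary.PropositionalEquality
open import Relation.Nullary.Decidable using (toWitness)

-- There is no quotient: reals are Cauchy sequences of rationals, and _≈_
-- is the equality of their limits.

IsCauchy : (ℕ → ℚ) → Set
IsCauchy s = ∀ δ → 0ℚ ℚ.< δ →
  ∃[ N ] (∀ m n → N ℕ.≤ m → N ℕ.≤ n → ℚ.∣ s m ℚ.- s n ∣ ℚ.≤ δ)

record ℝ : Set where
  no-eta-equality
  constructor mkℝ
  field
    seq    : ℕ → ℚ
    cauchy : IsCauchy seq

open ℝ public

infix 4 _≤_ _<_ _≈_

_≤_ : ℝ → ℝ → Set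
x ≤ y = ∀ δ → 0ℚ ℚ.< δ →
  ∃[ N ] (∀ n → N ℕ.≤ n → seq x n ℚ.≤ seq y n ℚ.+ δ)

_<_ : ℝ → ℝ → Set
x < y = ∃[ δ ] (0ℚ ℚ.< δ ×
  ∃[ N ] (∀ n → N ℕ.≤ n → seq x n ℚ.+ δ ℚ.≤ seq y n))

_≈_ : ℝ → ℝ → Set
x ≈ y = x ≤ y × y ≤ x

module Estimates where
  0<½ : 0ℚ ℚ.< ½
  0<½ = toWitness {a? = 0ℚ ℚ.<? ½} _

  0<1 : 0ℚ ℚ.< 1ℚ
  0<1 = toWitness {a? = 0ℚ ℚ.<? 1ℚ} _

  *-pos : ∀ {p q} → 0ℚ ℚ.< p → 0ℚ ℚ.< q → 0ℚ ℚ.< p ℚ.* q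
  *-pos {p} {q} 0<p 0<q = ℚₚ.positive⁻¹ (p ℚ.* q)
    {{ℚₚ.pos*pos⇒pos p {{ℚ.positive 0<p}} q {{ℚ.positive 0<q}}}}

  *-mono : ∀ {p q r s} → 0ℚ ℚ.≤ p → 0ℚ ℚ.≤ s →
           p ℚ.≤ q → r ℚ.≤ s → p ℚ.* r ℚ.≤ q ℚ.* s
  *-mono {p} {q} {r} {s} 0≤p 0≤s p≤q r≤s = ℚₚ.≤-trans
    (ℚₚ.*-monoˡ-≤-nonNeg p {{ℚ.nonNegative 0≤p}} r≤s)
    (ℚₚ.*-monoʳ-≤-nonNeg s {{ℚ.nonNegative 0≤s}} p≤q)

  ½+½ : ∀ δ → ½ ℚ.* δ ℚ.+ ½ ℚ.* δ ≡ δ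
  ½+½ δ = trans (sym (ℚₚ.*-distribʳ-+ δ ½ ½)) (ℚₚ.*-identityˡ δ)

  move : ∀ {p q r} → p ℚ.≤ q ℚ.+ r → p ℚ.- q ℚ.≤ r
  move {p} {q} {r} p≤q+r = subst (p ℚ.- q ℚ.≤_)
    (solve 2 (λ q r → q :+ r :- q := r) refl q r)
    (ℚₚ.+-monoˡ-≤ (ℚ.- q) p≤q+r)
    where open +-*-Solver

  ∣∣≤ : ∀ {p t} → p ℚ.≤ t → ℚ.- p ℚ.≤ t → ℚ.∣ p ∣ ℚ.≤ t
  ∣∣≤ {p} p≤t -p≤t with ℚₚ.∣p∣≡p∨∣p∣≡-p p
  ... | inj₁ eq = subst (ℚ._≤ _) (sym eq) p≤t
  ... | inj₂ eq = subst (ℚ._≤ _) (sym eq) -p≤t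

  ≤∣∣ : ∀ p → p ℚ.≤ ℚ.∣ p ∣
  ≤∣∣ p with ℚₚ.≤-total 0ℚ p
  ... | inj₁ 0≤p = ℚₚ.≤-reflexive (sym (ℚₚ.0≤p⇒∣p∣≡p 0≤p))
  ... | inj₂ p≤0 = ℚₚ.≤-trans p≤0 (ℚₚ.0≤∣p∣ p)

  -‿minus : ∀ p q → ℚ.- (p ℚ.- q) ≡ q ℚ.- p
  -‿minus = solve 2 (λ p q → :- (p :- q) := q :- p) refl
    where open +-*-Solver

  ∣minus∣-comm : ∀ p q → ℚ.∣ p ℚ.- q ∣ ≡ ℚ.∣ q ℚ.- p ∣
  ∣minus∣-comm p q =
    trans (sym (ℚₚ.∣-p∣≡∣p∣ (p ℚ.- q))) (cong ℚ.∣_∣ (-‿minus p q))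

  close : ∀ {L t a b} → L ℚ.≤ a → a ℚ.≤ L ℚ.+ t → L ℚ.≤ b → b ℚ.≤ L ℚ.+ t →
          ℚ.∣ a ℚ.- b ∣ ℚ.≤ t
  close {L} {t} {a} {b} L≤a a≤ L≤b b≤ = ∣∣≤
    (move (ℚₚ.≤-trans a≤ (ℚₚ.+-monoˡ-≤ t L≤b)))
    (subst (ℚ._≤ t) (sym (-‿minus a b))
      (move (ℚₚ.≤-trans b≤ (ℚₚ.+-monoˡ-≤ t L≤a))))

  eventuallyBounded : ∀ (x : ℝ) → ∃[ B ] ∃[ N ]
    (0ℚ ℚ.≤ B × (∀ n → N ℕ.≤ n → ℚ.∣ seq x n ∣ ℚ.≤ B))
  eventuallyBounded x with cauchy x 1ℚ 0<1
  ... | N , near = ℚ.∣ seq x N ∣ ℚ.+ 1ℚ , N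
      , ℚₚ.+-mono-≤ (ℚₚ.0≤∣p∣ (seq x N)) (ℚₚ.<⇒≤ 0<1)
      , λ n N≤n → ℚₚ.≤-trans
          (subst (λ z → ℚ.∣ z ∣ ℚ.≤ ℚ.∣ seq x N ∣ ℚ.+ ℚ.∣ seq x n ℚ.- seq x N ∣) (decompose (seq x n) (seq x N))
            (ℚₚ.∣p+q∣≤∣p∣+∣q∣ (seq x N) (seq x n ℚ.- seq x N)))
          (ℚₚ.+-monoʳ-≤ ℚ.∣ seq x N ∣ (near n N N≤n ℕₚ.≤-refl))
    where
    open +-*-Solver
    decompose : ∀ a b → b ℚ.+ (a ℚ.- b) ≡ a
    decompose = solve 2 (λ a b → b :+ (a :- b) := a) refl

open Estimates

const : ℚ → ℝ
const q .seq _ = q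
const q .cauchy δ 0<δ = 0 , λ _ _ _ _ →
  subst (λ z → ℚ.∣ z ∣ ℚ.≤ δ) (sym (ℚₚ.+-inverseʳ q)) (ℚₚ.<⇒≤ 0<δ)

0ℝ 1ℝ : ℝ
0ℝ = const 0ℚ
1ℝ = const 1ℚ

infixl 6 _+_ _-_
infixl 7 _*_

_+_ : ℝ → ℝ → ℝ
(x + y) .seq n = seq x n ℚ.+ seq y n
(x + y) .cauchy δ 0<δ
  with cauchy x (½ ℚ.* δ) (*-pos 0<½ 0<δ) | cauchy y (½ ℚ.* δ) (*-pos 0<½ 0<δ)
... | M , nearˣ | N , nearʸ = M ℕ.⊔ N , λ m n ≤m ≤n → begin
  ℚ.∣ (seq x m ℚ.+ seq y m) ℚ.- (seq x n ℚ.+ seq y n) ∣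
    ≡⟨ cong ℚ.∣_∣ (regroup (seq x m) (seq y m) (seq x n) (seq y n)) ⟩
  ℚ.∣ (seq x m ℚ.- seq x n) ℚ.+ (seq y m ℚ.- seq y n) ∣
    ≤⟨ ℚₚ.∣p+q∣≤∣p∣+∣q∣ (seq x m ℚ.- seq x n) (seq y m ℚ.- seq y n) ⟩
  ℚ.∣ seq x m ℚ.- seq x n ∣ ℚ.+ ℚ.∣ seq y m ℚ.- seq y n ∣
    ≤⟨ ℚₚ.+-mono-≤
         (nearˣ m n (ℕₚ.m⊔n≤o⇒m≤o M N ≤m) (ℕₚ.m⊔n≤o⇒m≤o M N ≤n))
         (nearʸ m n (ℕₚ.m⊔n≤o⇒n≤o M N ≤m) (ℕₚ.m⊔n≤o⇒n≤o M N ≤n)) ⟩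
  ½ ℚ.* δ ℚ.+ ½ ℚ.* δ
    ≡⟨ ½+½ δ ⟩
  δ ∎
  where
  open ℚₚ.≤-Reasoning
  open +-*-Solver
  regroup : ∀ a b c d →
    (a ℚ.+ b) ℚ.- (c ℚ.+ d) ≡ (a ℚ.- c) ℚ.+ (b ℚ.- d)
  regroup = solve 4 (λ a b c d → (a :+ b) :- (c :+ d) := (a :- c) :+ (b :- d)) refl

-_ : ℝ → ℝ
(- x) .seq n = ℚ.- seq x n
(- x) .cauchy δ 0<δ with cauchy x δ 0<δ
... | N , near = N , λ m n ≤m ≤n →
  subst (λ z → ℚ.∣ z ∣ ℚ.≤ δ) (swap (seq x m) (seq x n)) (near n m ≤n ≤m)
  where
  open +-*-Solver
  swap : ∀ a b → b ℚ.- a ≡ (ℚ.- a) ℚ.- (ℚ.- b)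
  swap = solve 2 (λ a b → b :- a := (:- a) :- (:- b)) refl

_-_ : ℝ → ℝ → ℝ
x - y = x + (- y)

module ProductEstimates where
  scale : ∀ A B δ → 0ℚ ℚ.≤ A → 0ℚ ℚ.≤ B → 0ℚ ℚ.< δ →
          ∃[ η ] (0ℚ ℚ.< η × (A ℚ.+ B) ℚ.* η ℚ.≤ δ)
  scale A B δ 0≤A 0≤B 0<δ = η , 0<η , (begin
    (A ℚ.+ B) ℚ.* η      ≤⟨ ℚₚ.*-monoʳ-≤-nonNeg η {{ℚ.nonNegative (ℚₚ.<⇒≤ 0<η)}} A+B≤C ⟩
    C ℚ.* η              ≡⟨ sym (ℚₚ.*-assoc C (ℚ.1/ C) δ) ⟩
    (C ℚ.* (ℚ.1/ C)) ℚ.* δ ≡⟨ cong (ℚ._* δ) (ℚₚ.*-inverseʳ C) ⟩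
    1ℚ ℚ.* δ             ≡⟨ ℚₚ.*-identityˡ δ ⟩
    δ ∎)
    where
    open ℚₚ.≤-Reasoning
    C = (A ℚ.+ B) ℚ.+ 1ℚ
    instance
      C-pos : ℚ.Positive C
      C-pos = ℚ.positive (ℚₚ.+-mono-≤-< (ℚₚ.+-mono-≤ 0≤A 0≤B) 0<1)
      C-nonZero : ℚ.NonZero C
      C-nonZero = ℚₚ.pos⇒nonZero C
    η = (ℚ.1/ C) ℚ.* δ
    0<η : 0ℚ ℚ.< η
    0<η = *-pos (ℚₚ.positive⁻¹ (ℚ.1/ C) {{ℚₚ.1/pos⇒pos C}}) 0<δ
    A+B≤C : A ℚ.+ B ℚ.≤ C
    A+B≤C = subst (ℚ._≤ C) (ℚₚ.+-identityʳ (A ℚ.+ B))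
              (ℚₚ.+-monoʳ-≤ (A ℚ.+ B) (ℚₚ.<⇒≤ 0<1))

  *-close : ∀ {A B η} a b c d → 0ℚ ℚ.≤ η → ℚ.∣ a ∣ ℚ.≤ A → ℚ.∣ d ∣ ℚ.≤ B →
            ℚ.∣ a ℚ.- c ∣ ℚ.≤ η → ℚ.∣ b ℚ.- d ∣ ℚ.≤ η →
            ℚ.∣ a ℚ.* b ℚ.- c ℚ.* d ∣ ℚ.≤ (A ℚ.+ B) ℚ.* η
  *-close {A} {B} {η} a b c d 0≤η a≤A d≤B a-c≤η b-d≤η = begin
    ℚ.∣ a ℚ.* b ℚ.- c ℚ.* d ∣
      ≡⟨ cong ℚ.∣_∣ (regroup a b c d) ⟩
    ℚ.∣ a ℚ.* (b ℚ.- d) ℚ.+ d ℚ.* (a ℚ.- c) ∣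
      ≤⟨ ℚₚ.∣p+q∣≤∣p∣+∣q∣ (a ℚ.* (b ℚ.- d)) (d ℚ.* (a ℚ.- c)) ⟩
    ℚ.∣ a ℚ.* (b ℚ.- d) ∣ ℚ.+ ℚ.∣ d ℚ.* (a ℚ.- c) ∣
      ≡⟨ cong₂ ℚ._+_ (ℚₚ.∣p*q∣≡∣p∣*∣q∣ a (b ℚ.- d))
                     (ℚₚ.∣p*q∣≡∣p∣*∣q∣ d (a ℚ.- c)) ⟩
    ℚ.∣ a ∣ ℚ.* ℚ.∣ b ℚ.- d ∣ ℚ.+ ℚ.∣ d ∣ ℚ.* ℚ.∣ a ℚ.- c ∣
      ≤⟨ ℚₚ.+-mono-≤ (*-mono (ℚₚ.0≤∣p∣ a) 0≤η a≤A b-d≤η)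
                     (*-mono (ℚₚ.0≤∣p∣ d) 0≤η d≤B a-c≤η) ⟩
    A ℚ.* η ℚ.+ B ℚ.* η
      ≡⟨ sym (ℚₚ.*-distribʳ-+ η A B) ⟩
    (A ℚ.+ B) ℚ.* η ∎
    where
    open ℚₚ.≤-Reasoning
    open +-*-Solver
    regroup : ∀ a b c d →
      a ℚ.* b ℚ.- c ℚ.* d ≡ a ℚ.* (b ℚ.- d) ℚ.+ d ℚ.* (a ℚ.- c)
    regroup = solve 4 (λ a b c d →
      a :* b :- c :* d := a :* (b :- d) :+ d :* (a :- c)) refl

  max₄ : ∀ a b c d → ∃[ K ] (∀ m → K ℕ.≤ m →
           a ℕ.≤ m × b ℕ.≤ m × c ℕ.≤ m × d ℕ.≤ m)
  max₄ a b c d = (a ℕ.⊔ b) ℕ.⊔ (c ℕ.⊔ d) , λ m K≤m →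
    let ab≤m = ℕₚ.m⊔n≤o⇒m≤o (a ℕ.⊔ b) (c ℕ.⊔ d) K≤m
        cd≤m = ℕₚ.m⊔n≤o⇒n≤o (a ℕ.⊔ b) (c ℕ.⊔ d) K≤m
    in ℕₚ.m⊔n≤o⇒m≤o a b ab≤m , ℕₚ.m⊔n≤o⇒n≤o a b ab≤m ,
       ℕₚ.m⊔n≤o⇒m≤o c d cd≤m , ℕₚ.m⊔n≤o⇒n≤o c d cd≤m

  *-cauchy : (x y : ℝ) → IsCauchy (λ n → seq x n ℚ.* seq y n)
  *-cauchy x y δ 0<δ =
    let A , M₁ , 0≤A , x≤A = eventuallyBounded x
        B , M₂ , 0≤B , y≤B = eventuallyBounded y
        η , 0<η , fits = scale A B δ 0≤A 0≤B 0<δ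
        N₁ , nearˣ = cauchy x η 0<η
        N₂ , nearʸ = cauchy y η 0<η
        K , K-max = max₄ M₁ M₂ N₁ N₂
    in K , λ m n K≤m K≤n →
      let M₁≤m , M₂≤m , N₁≤m , N₂≤m = K-max m K≤m
          M₁≤n , M₂≤n , N₁≤n , N₂≤n = K-max n K≤n
      in ℚₚ.≤-trans
           (*-close (seq x m) (seq y m) (seq x n) (seq y n) (ℚₚ.<⇒≤ 0<η)
             (x≤A m M₁≤m) (y≤B n M₂≤n)
             (nearˣ m n N₁≤m N₁≤n) (nearʸ m n N₂≤m N₂≤n))
           fits

open ProductEstimates

_*_ : ℝ → ℝ → ℝ
(x * y) .seq n = seq x n ℚ.* seq y n
(x * y) .cauchy = *-cauchy x y

module ReciprocalEstimates where
  ⊔-nonexpansive : ∀ k a b → ℚ.∣ (k ℚ.⊔ a) ℚ.- (k ℚ.⊔ b) ∣ ℚ.≤ ℚ.∣ a ℚ.- b ∣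
  ⊔-nonexpansive k a b = ∣∣≤ (half a b)
    (subst₂ ℚ._≤_ (sym (-‿minus (k ℚ.⊔ a) (k ℚ.⊔ b))) (∣minus∣-comm b a) (half b a))
    where
    open +-*-Solver
    undo : ∀ c d → d ℚ.+ (c ℚ.- d) ≡ c
    undo = solve 2 (λ c d → d :+ (c :- d) := c) refl
    half : ∀ c d → (k ℚ.⊔ c) ℚ.- (k ℚ.⊔ d) ℚ.≤ ℚ.∣ c ℚ.- d ∣
    half c d = move (ℚₚ.⊔-lub
      (subst (ℚ._≤ (k ℚ.⊔ d) ℚ.+ ℚ.∣ c ℚ.- d ∣) (ℚₚ.+-identityʳ k)
        (ℚₚ.+-mono-≤ (ℚₚ.p≤p⊔q k d) (ℚₚ.0≤∣p∣ (c ℚ.- d))))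
      (subst (ℚ._≤ (k ℚ.⊔ d) ℚ.+ ℚ.∣ c ℚ.- d ∣) (undo c d)
        (ℚₚ.+-mono-≤ (ℚₚ.p≤q⊔p k d) (≤∣∣ (c ℚ.- d)))))

  ⊔-pos : ∀ {k} a → 0ℚ ℚ.< k → ℚ.Positive (k ℚ.⊔ a)
  ⊔-pos {k} a 0<k = ℚ.positive (ℚₚ.<-≤-trans 0<k (ℚₚ.p≤p⊔q k a))

  recip : ∀ p → ℚ.Positive p → ℚ
  recip p p>0 = (ℚ.1/ p) {{ℚₚ.pos⇒nonZero p {{p>0}}}}

  recip-anti : ∀ p q (p>0 : ℚ.Positive p) (q>0 : ℚ.Positive q) →
               p ℚ.≤ q → recip q q>0 ℚ.≤ recip p p>0
  recip-anti p q p>0 q>0 p≤q =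
    ℚₚ.*-cancelˡ-≤-pos p {{p>0}} (ℚₚ.≤-trans
      (ℚₚ.*-monoʳ-≤-nonNeg (recip q q>0)
         {{ℚₚ.pos⇒nonNeg (recip q q>0) {{ℚₚ.1/pos⇒pos q {{q>0}}}}}} p≤q)
      (ℚₚ.≤-reflexive (trans
        (ℚₚ.*-inverseʳ q {{ℚₚ.pos⇒nonZero q {{q>0}}}})
        (sym (ℚₚ.*-inverseʳ p {{ℚₚ.pos⇒nonZero p {{p>0}}}})))))

  recip-nonNeg : ∀ p (p>0 : ℚ.Positive p) → 0ℚ ℚ.≤ recip p p>0
  recip-nonNeg p p>0 =
    ℚₚ.<⇒≤ (ℚₚ.positive⁻¹ (recip p p>0) {{ℚₚ.1/pos⇒pos p {{p>0}}}})

  recip-inverse : ∀ p (p>0 : ℚ.Positive p) → p ℚ.* recip p p>0 ≡ 1ℚ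
  recip-inverse p p>0 = ℚₚ.*-inverseʳ p {{ℚₚ.pos⇒nonZero p {{p>0}}}}

  recip-diff : ∀ p q u v → p ℚ.* u ≡ 1ℚ → q ℚ.* v ≡ 1ℚ →
               u ℚ.- v ≡ (u ℚ.* v) ℚ.* (q ℚ.- p)
  recip-diff p q u v pu qv = trans
    (cong₂ ℚ._-_ (sym (trans (cong (u ℚ.*_) qv) (ℚₚ.*-identityʳ u)))
                 (sym (trans (cong (v ℚ.*_) pu) (ℚₚ.*-identityʳ v))))
    (solve 4 (λ p q u v →
       u :* (q :* v) :- v :* (p :* u) := (u :* v) :* (q :- p)) refl p q u v)
    where open +-*-Solver

  recip-cancel : ∀ k r δ → k ℚ.* r ≡ 1ℚ → (r ℚ.* r) ℚ.* (k ℚ.* k ℚ.* δ) ≡ δ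
  recip-cancel k r δ kr = trans
    (solve 3 (λ k r δ →
       (r :* r) :* (k :* k :* δ) := (k :* r) :* ((k :* r) :* δ)) refl k r δ)
    (trans (cong (λ z → z ℚ.* (z ℚ.* δ)) kr)
      (trans (ℚₚ.*-identityˡ _) (ℚₚ.*-identityˡ δ)))
    where open +-*-Solver

  recip-close : ∀ k p q δ (k>0 : ℚ.Positive k)
    (p>0 : ℚ.Positive p) (q>0 : ℚ.Positive q) → 0ℚ ℚ.< δ →
    k ℚ.≤ p → k ℚ.≤ q → ℚ.∣ p ℚ.- q ∣ ℚ.≤ k ℚ.* k ℚ.* δ →
    ℚ.∣ recip p p>0 ℚ.- recip q q>0 ∣ ℚ.≤ δ
  recip-close k p q δ k>0 p>0 q>0 0<δ k≤p k≤q near =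
    go (recip p p>0) (recip q q>0) (recip k k>0)
       (recip-inverse p p>0) (recip-inverse q q>0) (recip-inverse k k>0)
       (recip-nonNeg p p>0) (recip-nonNeg q q>0) (recip-nonNeg k k>0)
       (recip-anti k p k>0 p>0 k≤p) (recip-anti k q k>0 q>0 k≤q)
    where
    open ℚₚ.≤-Reasoning
    0<k : 0ℚ ℚ.< k
    0<k = ℚₚ.positive⁻¹ k {{k>0}}
    go : ∀ u v r → p ℚ.* u ≡ 1ℚ → q ℚ.* v ≡ 1ℚ → k ℚ.* r ≡ 1ℚ →
         0ℚ ℚ.≤ u → 0ℚ ℚ.≤ v → 0ℚ ℚ.≤ r → u ℚ.≤ r → v ℚ.≤ r →
         ℚ.∣ u ℚ.- v ∣ ℚ.≤ δ
    go u v r pu qv kr 0≤u 0≤v 0≤r u≤r v≤r = begin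
      ℚ.∣ u ℚ.- v ∣
        ≡⟨ cong ℚ.∣_∣ (recip-diff p q u v pu qv) ⟩
      ℚ.∣ (u ℚ.* v) ℚ.* (q ℚ.- p) ∣
        ≡⟨ ℚₚ.∣p*q∣≡∣p∣*∣q∣ (u ℚ.* v) (q ℚ.- p) ⟩
      ℚ.∣ u ℚ.* v ∣ ℚ.* ℚ.∣ q ℚ.- p ∣
        ≡⟨ cong₂ ℚ._*_ (ℚₚ.0≤p⇒∣p∣≡p 0≤uv) (∣minus∣-comm q p) ⟩
      (u ℚ.* v) ℚ.* ℚ.∣ p ℚ.- q ∣
        ≤⟨ *-mono 0≤uv (ℚₚ.<⇒≤ (*-pos (*-pos 0<k 0<k) 0<δ))
                  (*-mono 0≤u 0≤r u≤r v≤r) near ⟩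
      (r ℚ.* r) ℚ.* (k ℚ.* k ℚ.* δ)
        ≡⟨ recip-cancel k r δ kr ⟩
      δ ∎
      where
      0≤uv : 0ℚ ℚ.≤ u ℚ.* v
      0≤uv = subst (ℚ._≤ u ℚ.* v) (ℚₚ.*-zeroˡ 0ℚ) (*-mono ℚₚ.≤-refl 0≤v 0≤u 0≤v)

open ReciprocalEstimates

-- The inverse of a positive real x.  Since x exceeds some rational k > 0
-- from some index on, replacing each term by its maximum with k does not
-- change the limit and makes all terms invertible.
inv : (x : ℝ) → 0ℝ < x → ℝ
inv x (k , 0<k , _) .seq n =
  (ℚ.1/ (k ℚ.⊔ seq x n)) {{ℚₚ.pos⇒nonZero (k ℚ.⊔ seq x n) {{⊔-pos (seq x n) 0<k}}}}
inv x (k , 0<k , _) .cauchy δ 0<δ =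
  let N , near = cauchy x (k ℚ.* k ℚ.* δ) (*-pos (*-pos 0<k 0<k) 0<δ)
  in N , λ m n N≤m N≤n →
    recip-close k (k ℚ.⊔ seq x m) (k ℚ.⊔ seq x n) δ (ℚ.positive 0<k)
      (⊔-pos (seq x m) 0<k) (⊔-pos (seq x n) 0<k) 0<δ
      (ℚₚ.p≤p⊔q k (seq x m)) (ℚₚ.p≤p⊔q k (seq x n))
      (ℚₚ.≤-trans (⊔-nonexpansive k (seq x m) (seq x n)) (near m n N≤m N≤n))

1/_! : ℕ → ℚ
1/ n ! = (+ 1 ℚ./ n !) {{n ℕₚ.!≢0}}

eSum : ℕ → ℚ
eSum zero    = 1/ 0 !
eSum (suc n) = eSum n ℚ.+ 1/ suc n !

module ExponentialEstimates where
  cross : ∀ M P → M ℕ.+ M ℕ.≤ P →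
          (1 ℕ.* P ℕ.+ 1 ℕ.* P) ℕ.* M ℕ.≤ 1 ℕ.* (P ℕ.* P)
  cross M P 2M≤P rewrite ℕₚ.*-identityˡ P | ℕₚ.*-identityˡ (P ℕ.* P)
    | ℕₚ.*-distribʳ-+ M P P | sym (ℕₚ.*-distribˡ-+ P M M) = ℕₚ.*-monoʳ-≤ P 2M≤P

  half-≤ : ∀ m p .{{_ : ℕ.NonZero m}} .{{_ : ℕ.NonZero p}} → m ℕ.+ m ℕ.≤ p →
           (+ 1 ℚ./ p) ℚ.+ (+ 1 ℚ./ p) ℚ.≤ + 1 ℚ./ m
  half-≤ (suc m) (suc p) 2m≤p = ℚₚ.toℚᵘ-cancel-≤ (begin
    ℚ.toℚᵘ ((+ 1 ℚ./ suc p) ℚ.+ (+ 1 ℚ./ suc p))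
      ≃⟨ ℚₚ.toℚᵘ-homo-+ (+ 1 ℚ./ suc p) (+ 1 ℚ./ suc p) ⟩
    ℚ.toℚᵘ (+ 1 ℚ./ suc p) ℚᵘ.+ ℚ.toℚᵘ (+ 1 ℚ./ suc p)
      ≃⟨ ℚᵘₚ.+-cong (ℚₚ.toℚᵘ-fromℚᵘ 1/p) (ℚₚ.toℚᵘ-fromℚᵘ 1/p) ⟩
    1/p ℚᵘ.+ 1/p
      ≤⟨ ℚᵘ.*≤* (ℤ.+≤+ (cross (suc m) (suc p) 2m≤p)) ⟩
    1/m
      ≃⟨ ℚᵘₚ.≃-sym (ℚₚ.toℚᵘ-fromℚᵘ 1/m) ⟩
    ℚ.toℚᵘ (+ 1 ℚ./ suc m) ∎)
    where
    open ℚᵘₚ.≤-Reasoning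
    1/p = ℚᵘ.mkℚᵘ (+ 1) p
    1/m = ℚᵘ.mkℚᵘ (+ 1) m

  n≤n! : ∀ n → n ℕ.≤ n !
  n≤n! zero    = ℕ.z≤n
  n≤n! (suc n) = subst (ℕ._≤ suc n !) (ℕₚ.*-identityʳ (suc n))
    (ℕₚ.*-monoʳ-≤ (suc n) (ℕₚ.n≢0⇒n>0 (ℕ.≢-nonZero⁻¹ (n !) {{n ℕₚ.!≢0}})))

  0<1/! : ∀ n → 0ℚ ℚ.< 1/ n !
  0<1/! n = ℚₚ.positive⁻¹ (1/ n !) {{ℚₚ.normalize-pos 1 (n !) {{n ℕₚ.!≢0}}}}

  1/!-halves : ∀ n → 1/ suc (suc n) ! ℚ.+ 1/ suc (suc n) ! ℚ.≤ 1/ suc n !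
  1/!-halves n = half-≤ (suc n !) (suc (suc n) !)
    {{suc n ℕₚ.!≢0}} {{suc (suc n) ℕₚ.!≢0}}
    (ℕₚ.+-monoʳ-≤ (suc n !) (ℕₚ.m≤m+n (suc n !) (n ℕ.* suc n !)))

  tail : ℕ → ℚ
  tail n = 1/ suc n ! ℚ.+ 1/ suc n !

  eSum-up : ∀ k n → eSum n ℚ.≤ eSum (k ℕ.+ n)
  eSum-up zero    n = ℚₚ.≤-refl
  eSum-up (suc k) n = subst (ℚ._≤ eSum (suc k ℕ.+ n)) (ℚₚ.+-identityʳ (eSum n))
    (ℚₚ.+-mono-≤ (eSum-up k n) (ℚₚ.<⇒≤ (0<1/! (suc k ℕ.+ n))))

  eSum-down : ∀ k n → eSum (k ℕ.+ n) ℚ.+ tail (k ℕ.+ n) ℚ.≤ eSum n ℚ.+ tail n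
  eSum-down zero    n = ℚₚ.≤-refl
  eSum-down (suc k) n = ℚₚ.≤-trans
    (ℚₚ.≤-trans
      (ℚₚ.+-monoʳ-≤ (eSum (suc k ℕ.+ n)) (1/!-halves (k ℕ.+ n)))
      (ℚₚ.≤-reflexive (ℚₚ.+-assoc (eSum (k ℕ.+ n)) _ _)))
    (eSum-down k n)

  eSum-bounds : ∀ {N n} → N ℕ.≤ n →
                eSum N ℚ.≤ eSum n × eSum n ℚ.≤ eSum N ℚ.+ tail N
  eSum-bounds {N} {n} N≤n rewrite sym (ℕₚ.m∸n+n≡m N≤n) =
    eSum-up (n ℕ.∸ N) N ,
    ℚₚ.≤-trans
      (subst (ℚ._≤ eSum k ℚ.+ tail k) (ℚₚ.+-identityʳ (eSum k))
        (ℚₚ.+-monoʳ-≤ (eSum k)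
          (ℚₚ.<⇒≤ (ℚₚ.+-mono-< (0<1/! (suc k)) (0<1/! (suc k))))))
      (eSum-down (n ℕ.∸ N) N)
    where k = n ℕ.∸ N ℕ.+ N

  tail-small : ∀ δ → 0ℚ ℚ.< δ → ∃[ N ] tail N ℚ.≤ δ
  tail-small δ@(mkℚ +[1+ a ] d c) _ = N , ℚₚ.≤-trans
    (half-≤ (suc d) (suc N !) {{_}} {{suc N ℕₚ.!≢0}}
      (ℕₚ.≤-trans (ℕₚ.n≤1+n N) (n≤n! (suc N))))
    (ℚₚ.toℚᵘ-cancel-≤ (ℚᵘₚ.≤-trans
      (ℚᵘₚ.≤-reflexive (ℚₚ.toℚᵘ-fromℚᵘ (ℚᵘ.mkℚᵘ (+ 1) d)))
      (ℚᵘ.*≤* (ℤ.+≤+ (ℕₚ.*-monoˡ-≤ (suc d) (ℕ.s≤s (ℕ.z≤n {a})))))))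
    where N = suc d ℕ.+ suc d
  tail-small (mkℚ (+ 0) _ _)      (ℚ.*<* (ℤ.+<+ ()))
  tail-small (mkℚ (ℤ.-[1+ _ ]) _ _) (ℚ.*<* ())

open ExponentialEstimates

e : ℝ
e .seq = eSum
e .cauchy δ 0<δ with tail-small δ 0<δ
... | N , small = N , λ m n ≤m ≤n →
  let L≤m , m≤L+ = eSum-bounds ≤m
      L≤n , n≤L+ = eSum-bounds ≤n
  in ℚₚ.≤-trans (close L≤m m≤L+ L≤n n≤L+) small

0<e : 0ℝ < e
0<e = 1ℚ , 0<1 , 0 , λ n _ →
  subst (ℚ._≤ eSum n) (sym (ℚₚ.+-identityˡ 1ℚ)) (proj₁ (eSum-bounds {0} {n} ℕ.z≤n))

1/e : ℝ
1/e = inv e 0<e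

∑ ∏ : ∀ {n} → (Fin n → ℝ) → ℝ
∑ = Vector.foldr _+_ 0ℝ
∏ = Vector.foldr _*_ 1ℝ

∑-subsets : ∀ {n} → (Subset n → ℝ) → ℝ
∑-subsets {zero}  f = f []
∑-subsets {suc n} f =
  ∑-subsets (λ R → f (inside ∷ R)) + ∑-subsets (λ R → f (outside ∷ R))

-- The ground set is Fin n; feasible sets are those with at most one element.

record 𝒫 (n : ℕ) : Set where
  field
    coord   : Fin n → ℝ
    coord≥0 : ∀ i → 0ℝ ≤ coord i
    coord≤1 : ∀ i → coord i ≤ 1ℝ
    ∑coord≤1 : ∑ coord ≤ 1ℝ

open 𝒫 public

record DownClosedFamily (n : ℕ) : Set where
  field
    member     : Subset n → Bool
    feasible   : ∀ S → T (member S) → ∣ S ∣ ℕ.≤ 1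
    downClosed : ∀ S S′ → S ⊆ S′ → T (member S′) → T (member S)

open DownClosedFamily public

-- There are only finitely many families on Fin n, so a random family is
-- given by a finite probability space of seeds.
record RandomFamily (n : ℕ) : Set where
  field
    seeds     : ℕ
    weight    : Fin seeds → ℝ
    weight≥0  : ∀ ω → 0ℝ ≤ weight ω
    ∑weight≈1 : ∑ weight ≈ 1ℝ
    family    : Fin seeds → DownClosedFamily n

open RandomFamily public

GreedyOCRS : Set
GreedyOCRS = ∀ n → 𝒫 n → RandomFamily n

module _ {n : ℕ} where

  step : DownClosedFamily n → Subset n → Subset n → Fin n → Subset n
  step F R S i =
    if lookup R i ∧ member F (S ∪ ⁅ i ⁆) then S ∪ ⁅ i ⁆ else S

  -- The k-th element to arrive is π ⟨$⟩ʳ k.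
  selected : DownClosedFamily n → Subset n → Permutation′ n → Subset n
  selected F R π = foldl (step F R) ⊥ (map (π ⟨$⟩ʳ_) (allFin n))

  Adversary : RandomFamily n → Set
  Adversary F = Fin (seeds F) → Subset n → Permutation′ n

  Event : RandomFamily n → Set
  Event F = Fin (seeds F) → Subset n → Bool

  prActiveSet : 𝒫 n → Subset n → ℝ
  prActiveSet x R = ∏ λ i → if lookup R i then coord x i else 1ℝ - coord x i

  -- The seed and the active set are independent.
  Pr : 𝒫 n → (F : RandomFamily n) → Event F → ℝ
  Pr x F E = ∑ λ ω → weight F ω *
    ∑-subsets λ R → if E ω R then prActiveSet x R else 0ℝ

  condPr : (x : 𝒫 n) (F : RandomFamily n) (A B : Event F) → 0ℝ < Pr x F B → ℝ
  condPr x F A B PrB>0 = Pr x F (λ ω R → A ω R ∧ B ω R) * inv (Pr x F B) PrB>0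

  active : (F : RandomFamily n) → Fin n → Event F
  active F i ω R = lookup R i

  selects : (F : RandomFamily n) → Adversary F → Fin n → Event F
  selects F adv i ω R = lookup (selected (family F ω) R (adv ω R)) i

module ActiveProbability where
  module _ (k : ℕ) where

    ∑-subsets-cong : ∀ {n} {f g : Subset n → ℝ} →
      (∀ R → seq (f R) k ≡ seq (g R) k) →
      seq (∑-subsets f) k ≡ seq (∑-subsets g) k
    ∑-subsets-cong {zero}  f≗g = f≗g []
    ∑-subsets-cong {suc n} f≗g = cong₂ ℚ._+_
      (∑-subsets-cong (λ R → f≗g (inside ∷ R)))
      (∑-subsets-cong (λ R → f≗g (outside ∷ R)))

    ∑-subsets-*ˡ : ∀ {n} (c : ℝ) (f : Subset n → ℝ) →
      seq (∑-subsets (λ R → c * f R)) k ≡ seq c k ℚ.* seq (∑-subsets f) k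
    ∑-subsets-*ˡ {zero}  c f = refl
    ∑-subsets-*ˡ {suc n} c f = trans
      (cong₂ ℚ._+_ (∑-subsets-*ˡ c fᵢ) (∑-subsets-*ˡ c fₒ))
      (sym (ℚₚ.*-distribˡ-+ (seq c k) (seq (∑-subsets fᵢ) k) (seq (∑-subsets fₒ) k)))
      where
      fᵢ fₒ : Subset n → ℝ
      fᵢ R = f (inside ∷ R)
      fₒ R = f (outside ∷ R)

    ∑-subsets-0 : ∀ n → seq (∑-subsets {n} (λ _ → 0ℝ)) k ≡ 0ℚ
    ∑-subsets-0 zero    = refl
    ∑-subsets-0 (suc n) = cong₂ ℚ._+_ (∑-subsets-0 n) (∑-subsets-0 n)

    prSet : ∀ {n} → (Fin n → ℝ) → Subset n → ℝ
    prSet x R = ∏ λ i → if lookup R i then x i else 1ℝ - x i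

    complement : ∀ a b → a ℚ.* b ℚ.+ (1ℚ ℚ.- a) ℚ.* b ≡ b
    complement a b = trans (sym (ℚₚ.*-distribʳ-+ b a (1ℚ ℚ.- a)))
      (trans (cong (ℚ._* b) (solve 2 (λ a o → a :+ (o :- a) := o) refl a 1ℚ))
             (ℚₚ.*-identityˡ b))
      where open +-*-Solver

    prSet-total : ∀ {n} (x : Fin n → ℝ) → seq (∑-subsets (prSet x)) k ≡ 1ℚ
    prSet-total {zero}  x = refl
    prSet-total {suc n} x = trans
      (cong₂ ℚ._+_ (∑-subsets-*ˡ (x zero) (prSet x′))
                   (∑-subsets-*ˡ (1ℝ - x zero) (prSet x′)))
      (trans (complement (seq (x zero) k) (seq (∑-subsets (prSet x′)) k))
             (prSet-total x′))
      where
      x′ : Fin n → ℝ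
      x′ i = x (suc i)

    scale-if : ∀ b (c y : ℝ) → seq (if b then c * y else 0ℝ) k ≡
                               seq (c * (if b then y else 0ℝ)) k
    scale-if true  c y = refl
    scale-if false c y = sym (ℚₚ.*-zeroʳ (seq c k))

    ifActive : ∀ {n} → (Fin n → ℝ) → Fin n → Subset n → ℝ
    ifActive x i R = if lookup R i then prSet x R else 0ℝ

    prSet-active : ∀ {n} (x : Fin n → ℝ) i →
      seq (∑-subsets (ifActive x i)) k ≡ seq (x i) k
    prSet-active {suc n} x zero = trans
      (cong₂ ℚ._+_
        (trans (∑-subsets-*ˡ (x zero) (prSet x′))
          (trans (cong (seq (x zero) k ℚ.*_) (prSet-total x′))
                 (ℚₚ.*-identityʳ (seq (x zero) k))))
        (∑-subsets-0 n))
      (ℚₚ.+-identityʳ (seq (x zero) k))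
      where
      x′ : Fin n → ℝ
      x′ i = x (suc i)
    prSet-active {suc n} x (suc i) = trans
      (cong₂ ℚ._+_ (side (x zero)) (side (1ℝ - x zero)))
      (trans (complement (seq (x zero) k) (seq (∑-subsets (ifActive x′ i)) k))
             (prSet-active x′ i))
      where
      x′ : Fin n → ℝ
      x′ j = x (suc j)
      side : ∀ c →
        seq (∑-subsets (λ R → if lookup R i then c * prSet x′ R else 0ℝ)) k ≡
        seq c k ℚ.* seq (∑-subsets (ifActive x′ i)) k
      side c = trans
        (∑-subsets-cong
          {f = λ R → if lookup R i then c * prSet x′ R else 0ℝ}
          {g = λ R → c * ifActive x′ i R}
          (λ R → scale-if (lookup R i) c (prSet x′ R)))
        (∑-subsets-*ˡ c (ifActive x′ i))

    ∑-*ʳ : ∀ {m} (w : Fin m → ℝ) (c : ℝ) →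
      seq (∑ (λ ω → w ω * c)) k ≡ seq (∑ w) k ℚ.* seq c k
    ∑-*ʳ {zero}  w c = sym (ℚₚ.*-zeroˡ (seq c k))
    ∑-*ʳ {suc m} w c = trans
      (cong (seq (w zero) k ℚ.* seq c k ℚ.+_) (∑-*ʳ w′ c))
      (sym (ℚₚ.*-distribʳ-+ (seq c k) (seq (w zero) k) (seq (∑ w′) k)))
      where
      w′ : Fin m → ℝ
      w′ ω = w (suc ω)

    Pr-active : ∀ {n} (x : 𝒫 n) F i →
      seq (Pr x F (active F i)) k ≡ seq (∑ (weight F)) k ℚ.* seq (coord x i) k
    Pr-active x F i = trans
      (∑-*ʳ (weight F) (∑-subsets (ifActive (coord x) i)))
      (cong (seq (∑ (weight F)) k ℚ.*_) (prSet-active (coord x) i))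

open ActiveProbability

active-pos : ∀ {n} (x : 𝒫 n) F i → 0ℝ < coord x i → 0ℝ < Pr x F (active F i)
active-pos x F i (δ , 0<δ , M , above) with proj₂ (∑weight≈1 F) ½ 0<½
... | N , near = ½ ℚ.* δ , *-pos 0<½ 0<δ , M ℕ.⊔ N , λ k ≤k →
  let w = seq (∑ (weight F)) k
      xᵢ = seq (coord x i) k
      ½≤w : ½ ℚ.≤ w
      ½≤w = subst (½ ℚ.≤_)
        (trans (ℚₚ.+-assoc w ½ (ℚ.- ½)) (ℚₚ.+-identityʳ w))
        (ℚₚ.+-monoˡ-≤ (ℚ.- ½) (near k (ℕₚ.m⊔n≤o⇒n≤o M N ≤k)))
      δ≤xᵢ : δ ℚ.≤ xᵢ
      δ≤xᵢ = subst (ℚ._≤ xᵢ) (ℚₚ.+-identityˡ δ) (above k (ℕₚ.m⊔n≤o⇒m≤o M N ≤k))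
  in subst₂ ℚ._≤_ (sym (ℚₚ.+-identityˡ (½ ℚ.* δ))) (sym (Pr-active k x F i))
       (*-mono (ℚₚ.<⇒≤ 0<½) (ℚₚ.≤-trans (ℚₚ.<⇒≤ 0<δ) δ≤xᵢ) ½≤w δ≤xᵢ)

prSelectedGivenActive :
  ∀ {n} (x : 𝒫 n) (F : RandomFamily n) → Adversary F →
  (i : Fin n) → 0ℝ < coord x i → ℝ
prSelectedGivenActive x F adv i xᵢ>0 =
  condPr x F (selects F adv i) (active F i) (active-pos x F i xᵢ>0)

{-# OPTIONS --safe #-}

-- On n elements with all probabilities equal to p = 1/n, let T be the set of
-- elements whose singleton lies in the family. An adversary that wants to block
-- i lets an active element of T other than i arrive first, so i is selected only
-- if T ∩ R = {i}. Summed over i, the probabilities of these events give the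
-- probability t p (1 − p)^(t − 1) that exactly one element of T is active, where
-- t = |T|; it is largest at t = n, with value (1 − p)^(n − 1). Hence the guarantee
-- is at most (1 − p)^(n − 1) ≤ (1 − p)^n + p ≤ 1/e + p.
--
-- The last inequality comes from the Taylor polynomials E of exp: they satisfy
-- (1 − h) E(t + h) ≤ E(t) for t, h ≥ 0, hence (1 − p)^n E(n p) ≤ 1.

module Submission where

open import Defs
open import Algebra.Bundles using (CommutativeRing)
import Algebra.Definitions.RawSemiring as RawSemiring
import Algebra.Properties.CommutativeMonoid.Sum as CommutativeMonoidSum
import Algebra.Properties.Semiring.Mult as Mult
import Algebra.Properties.Semiring.Sum as SemiringSum
open import Data.Bool using (Bool; true; false; if_then_else_; _∧_; T)
import Data.Bool.Properties as Boolₚ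
open import Data.Fin using (Fin; zero; suc)
open import Data.Fin.Permutation as Perm using (Permutation′; _⟨$⟩ʳ_)
import Data.Fin.Properties as Finₚ
open import Data.Fin.Subset
  using (Subset; inside; outside; ⊥; ⁅_⁆; _∪_; _∩_; _∈_; _∉_; ∣_∣)
import Data.Fin.Subset.Properties as Subsetₚ
open import Data.Integer as ℤ using (+_; +[1+_])
import Data.Integer.Properties as ℤₚ
import Data.Integer.Solver as ℤSolver
open import Data.List using ([]; _∷_; map; foldl; allFin; tabulate)
open import Data.Nat as ℕ using (ℕ; zero; suc; _!)
import Data.Nat.Properties as ℕₚ
open import Data.Product using (Σ-syntax; ∃-syntax; _×_; _,_; proj₁; proj₂)
open import Data.Rational as ℚ using (ℚ; mkℚ; 0ℚ; 1ℚ; ½)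
import Data.Rational.Properties as ℚₚ
open import Data.Rational.Solver using (module +-*-Solver)
import Data.Rational.Unnormalised as ℚᵘ
import Data.Rational.Unnormalised.Properties as ℚᵘₚ
open import Data.Sum using (inj₁; inj₂)
open import Data.Unit using (tt)
open import Data.Vec as Vec using ([]; _∷_; lookup; here; there)
import Data.Vec.Properties as Vecₚ
open import Function using (Equivalence)
open import Relation.Binary.PropositionalEquality
open import Relation.Nullary using (¬_; Dec; yes; no; contradiction)
open import Relation.Nullary.Decidable using (_×-dec_; ¬?; decidable-stable)

open Estimates
open ProductEstimates
open ReciprocalEstimates
open ExponentialEstimates
open ActiveProbability
open RawSemiring ℚ.+-*-rawSemiring using (_^_) renaming (_×_ to infixr 8 _·_)
open Mult (CommutativeRing.semiring ℚₚ.+-*-commutativeRing) using (×-assoc-*; ×-comm-*)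
open CommutativeMonoidSum ℚₚ.+-0-commutativeMonoid
  using (sum; sum-cong-≗; ∑-comm; ∑-distrib-+; sum-replicate)
open SemiringSum (CommutativeRing.semiring ℚₚ.+-*-commutativeRing)
  using (*-distribˡ-sum; *-distribʳ-sum)

-- Rational arithmetic: signs, multiples and unit fractions

+-nonNeg : ∀ {a b} → 0ℚ ℚ.≤ a → 0ℚ ℚ.≤ b → 0ℚ ℚ.≤ a ℚ.+ b
+-nonNeg = ℚₚ.+-mono-≤

*-nonNeg : ∀ {a b} → 0ℚ ℚ.≤ a → 0ℚ ℚ.≤ b → 0ℚ ℚ.≤ a ℚ.* b
*-nonNeg {a} {b} 0≤a 0≤b =
  subst (ℚ._≤ a ℚ.* b) (ℚₚ.*-zeroˡ 0ℚ) (*-mono ℚₚ.≤-refl 0≤b 0≤a 0≤b)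

+-≤ : ∀ {a b c} → 0ℚ ℚ.≤ c → a ℚ.+ c ≡ b → a ℚ.≤ b
+-≤ {a} {b} {c} 0≤c eq = subst₂ ℚ._≤_ (ℚₚ.+-identityʳ a) eq (ℚₚ.+-monoʳ-≤ a 0≤c)

≤⇒0≤- : ∀ {a b} → a ℚ.≤ b → 0ℚ ℚ.≤ b ℚ.- a
≤⇒0≤- {a} {b} a≤b = subst (ℚ._≤ b ℚ.- a) (ℚₚ.+-inverseʳ a) (ℚₚ.+-monoˡ-≤ (ℚ.- a) a≤b)

≤-scaleˡ : ∀ {a b} c → 0ℚ ℚ.≤ c → a ℚ.≤ b → c ℚ.* a ℚ.≤ c ℚ.* b
≤-scaleˡ c 0≤c a≤b = ℚₚ.*-monoˡ-≤-nonNeg c {{ℚ.nonNegative 0≤c}} a≤b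

·-nonNeg : ∀ j {a} → 0ℚ ℚ.≤ a → 0ℚ ℚ.≤ j · a
·-nonNeg zero    0≤a = ℚₚ.≤-refl
·-nonNeg (suc j) 0≤a = +-nonNeg 0≤a (·-nonNeg j 0≤a)

^-nonNeg : ∀ {a} → 0ℚ ℚ.≤ a → ∀ j → 0ℚ ℚ.≤ a ^ j
^-nonNeg 0≤a zero    = ℚₚ.<⇒≤ 0<1
^-nonNeg 0≤a (suc j) = *-nonNeg 0≤a (^-nonNeg 0≤a j)

·-unitFraction : ∀ j d → j · (+ 1 ℚ./ suc d) ≡ + j ℚ./ suc d
·-unitFraction j d = ℚₚ.toℚᵘ-injective
  (ℚᵘₚ.≃-trans (go j) (ℚᵘₚ.≃-sym (ℚₚ.toℚᵘ-fromℚᵘ (ℚᵘ.mkℚᵘ (+ j) d))))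
  where
  open ℤSolver.+-*-Solver
  go : ∀ j → ℚ.toℚᵘ (j · (+ 1 ℚ./ suc d)) ℚᵘ.≃ ℚᵘ.mkℚᵘ (+ j) d
  go zero    = ℚᵘ.*≡* refl
  go (suc j) = ℚᵘₚ.≃-trans (ℚₚ.toℚᵘ-homo-+ (+ 1 ℚ./ suc d) (j · (+ 1 ℚ./ suc d)))
    (ℚᵘₚ.≃-trans (ℚᵘₚ.+-cong (ℚₚ.toℚᵘ-fromℚᵘ (ℚᵘ.mkℚᵘ (+ 1) d)) (go j))
      (ℚᵘ.*≡* (solve 2 (λ i D →
        (con (+ 1) :* D :+ i :* D) :* D := (con (+ 1) :+ i) :* (D :* D)) refl (+ j) (+ suc d))))

1/!-suc : ∀ k → suc k · 1/ suc k ! ≡ 1/ k !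
1/!-suc k = go (suc k) (k !) {{_}} {{k ℕₚ.!≢0}} {{suc k ℕₚ.!≢0}}
  where
  go : ∀ a b .{{_ : ℕ.NonZero a}} .{{_ : ℕ.NonZero b}} .{{_ : ℕ.NonZero (a ℕ.* b)}} →
       a · (+ 1 ℚ./ (a ℕ.* b)) ≡ + 1 ℚ./ b
  go (suc a) (suc b) = trans (·-unitFraction (suc a) (b ℕ.+ a ℕ.* suc b))
    (ℚₚ.fromℚᵘ-cong {ℚᵘ.mkℚᵘ (+ suc a) (b ℕ.+ a ℕ.* suc b)} {ℚᵘ.mkℚᵘ (+ 1) b}
      (ℚᵘ.*≡* (sym (ℤₚ.*-identityˡ (+ (suc a ℕ.* suc b))))))

unitFraction : ∀ β → 0ℚ ℚ.< β → ∃[ m ] ∃[ p ] (0ℚ ℚ.< p × p ℚ.≤ β × suc m · p ≡ 1ℚ)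
-- The number of elements is the denominator `suc d` of `β`; as the numerator is at least 1, its
-- reciprocal is at most `β`.
unitFraction β@(mkℚ +[1+ a ] d c) _ = d , + 1 ℚ./ suc d
  , ℚₚ.positive⁻¹ _ {{ℚₚ.normalize-pos 1 (suc d)}}
  , ℚₚ.toℚᵘ-cancel-≤ (ℚᵘₚ.≤-trans
      (ℚᵘₚ.≤-reflexive (ℚₚ.toℚᵘ-fromℚᵘ (ℚᵘ.mkℚᵘ (+ 1) d)))
      (ℚᵘ.*≤* (ℤ.+≤+ (ℕₚ.*-monoˡ-≤ (suc d) (ℕ.s≤s (ℕ.z≤n {a}))))))
  , trans (·-unitFraction (suc d) d)
      (ℚₚ.fromℚᵘ-cong {ℚᵘ.mkℚᵘ (+ suc d) d} {ℚᵘ.mkℚᵘ (+ 1) 0}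
        (ℚᵘ.*≡* (ℤₚ.*-comm (+ suc d) (+ 1))))
unitFraction (mkℚ (+ 0) _ _)        (ℚ.*<* (ℤ.+<+ ()))
unitFraction (mkℚ (ℤ.-[1+ _ ]) _ _) (ℚ.*<* ())

-- Taylor polynomials of the exponential function

expTerm : ℕ → ℚ → ℚ
expTerm k t = t ^ k ℚ.* 1/ k !

expPoly : ℕ → ℚ → ℚ
expPoly zero    t = expTerm 0 t
expPoly (suc k) t = expPoly k t ℚ.+ expTerm (suc k) t

expPoly-0 : ∀ k → expPoly k 0ℚ ≡ 1ℚ
expPoly-0 zero    = refl
expPoly-0 (suc k) = trans (cong₂ ℚ._+_ (expPoly-0 k)
  (trans (cong (ℚ._* 1/ suc k !) (ℚₚ.*-zeroˡ (0ℚ ^ k))) (ℚₚ.*-zeroˡ (1/ suc k !))))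
  (ℚₚ.+-identityʳ 1ℚ)

1^ : ∀ k → 1ℚ ^ k ≡ 1ℚ
1^ zero    = refl
1^ (suc k) = trans (ℚₚ.*-identityˡ (1ℚ ^ k)) (1^ k)

expPoly-1 : ∀ k → expPoly k 1ℚ ≡ eSum k
expPoly-1 zero    = refl
expPoly-1 (suc k) = cong₂ ℚ._+_ (expPoly-1 k)
  (trans (cong (ℚ._* 1/ suc k !) (1^ (suc k))) (ℚₚ.*-identityˡ _))

-- A mean value bound: on the interval from `t` to `t + h` the derivative of the power is largest at
-- the right end. In the induction, `raise` replaces a factor `t` by `t + h`.
^-increment : ∀ {t h} → 0ℚ ℚ.≤ t → 0ℚ ℚ.≤ h → ∀ k →
  (t ℚ.+ h) ^ suc k ℚ.≤ t ^ suc k ℚ.+ suc k · (h ℚ.* (t ℚ.+ h) ^ k)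
^-increment {t} {h} 0≤t 0≤h zero = ℚₚ.≤-reflexive
  (solve 2 (λ t h → (t :+ h) :* con 1ℚ :=
     t :* con 1ℚ :+ (h :* con 1ℚ :+ con 0ℚ)) refl t h)
  where open +-*-Solver
^-increment {t} {h} 0≤t 0≤h (suc k) = begin
  s ℚ.* sᵏ⁺¹
    ≡⟨ ℚₚ.*-distribʳ-+ sᵏ⁺¹ t h ⟩
  t ℚ.* sᵏ⁺¹ ℚ.+ h ℚ.* sᵏ⁺¹
    ≤⟨ ℚₚ.+-monoˡ-≤ (h ℚ.* sᵏ⁺¹) (≤-scaleˡ t 0≤t (^-increment 0≤t 0≤h k)) ⟩
  t ℚ.* (tᵏ⁺¹ ℚ.+ suc k · (h ℚ.* s ^ k)) ℚ.+ h ℚ.* sᵏ⁺¹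
    ≡⟨ cong (ℚ._+ h ℚ.* sᵏ⁺¹) (ℚₚ.*-distribˡ-+ t tᵏ⁺¹ (suc k · (h ℚ.* s ^ k))) ⟩
  t ℚ.* tᵏ⁺¹ ℚ.+ t ℚ.* (suc k · (h ℚ.* s ^ k)) ℚ.+ h ℚ.* sᵏ⁺¹
    ≤⟨ ℚₚ.+-monoˡ-≤ (h ℚ.* sᵏ⁺¹) (ℚₚ.+-monoʳ-≤ (t ℚ.* tᵏ⁺¹) (raise (suc k))) ⟩
  t ℚ.* tᵏ⁺¹ ℚ.+ suc k · (h ℚ.* sᵏ⁺¹) ℚ.+ h ℚ.* sᵏ⁺¹
    ≡⟨ solve 3 (λ a b c → a :+ b :+ c := a :+ (c :+ b)) refl
         (t ℚ.* tᵏ⁺¹) (suc k · (h ℚ.* sᵏ⁺¹)) (h ℚ.* sᵏ⁺¹) ⟩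
  t ℚ.* tᵏ⁺¹ ℚ.+ suc (suc k) · (h ℚ.* sᵏ⁺¹) ∎
  where
  open ℚₚ.≤-Reasoning
  open +-*-Solver
  s = t ℚ.+ h
  sᵏ⁺¹ = s ^ suc k
  tᵏ⁺¹ = t ^ suc k
  raise : ∀ j → t ℚ.* (j · (h ℚ.* s ^ k)) ℚ.≤ j · (h ℚ.* sᵏ⁺¹)
  raise zero    = ℚₚ.≤-reflexive (ℚₚ.*-zeroʳ t)
  raise (suc j) = ℚₚ.≤-trans
    (ℚₚ.≤-reflexive (ℚₚ.*-distribˡ-+ t (h ℚ.* s ^ k) (j · (h ℚ.* s ^ k))))
    (ℚₚ.+-mono-≤
      (+-≤ {t ℚ.* (h ℚ.* s ^ k)} (*-nonNeg 0≤h (*-nonNeg 0≤h (^-nonNeg (+-nonNeg 0≤t 0≤h) k)))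
        (solve 3 (λ t h y → t :* (h :* y) :+ h :* (h :* y) := h :* ((t :+ h) :* y))
          refl t h (s ^ k)))
      (raise j))

-- The factor `suc k` from `^-increment` cancels against the factorial, just as differentiating a
-- Taylor term yields the preceding one.
expTerm-increment : ∀ {t h} → 0ℚ ℚ.≤ t → 0ℚ ℚ.≤ h → ∀ k →
  expTerm (suc k) (t ℚ.+ h) ℚ.≤ expTerm (suc k) t ℚ.+ h ℚ.* expTerm k (t ℚ.+ h)
expTerm-increment {t} {h} 0≤t 0≤h k = begin
  (t ℚ.+ h) ^ suc k ℚ.* f
    ≤⟨ ℚₚ.*-monoʳ-≤-nonNeg f {{ℚ.nonNegative (ℚₚ.<⇒≤ (0<1/! (suc k)))}}
         (^-increment 0≤t 0≤h k) ⟩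
  (t ^ suc k ℚ.+ suc k · y) ℚ.* f
    ≡⟨ ℚₚ.*-distribʳ-+ f (t ^ suc k) (suc k · y) ⟩
  t ^ suc k ℚ.* f ℚ.+ (suc k · y) ℚ.* f
    ≡⟨ cong (t ^ suc k ℚ.* f ℚ.+_) (trans (×-assoc-* (suc k) y f)
         (trans (trans (sym (×-comm-* (suc k) y f)) (cong (y ℚ.*_) (1/!-suc k)))
           (ℚₚ.*-assoc h ((t ℚ.+ h) ^ k) (1/ k !)))) ⟩
  t ^ suc k ℚ.* f ℚ.+ h ℚ.* ((t ℚ.+ h) ^ k ℚ.* 1/ k !) ∎
  where
  open ℚₚ.≤-Reasoning
  f = 1/ suc k !
  y = h ℚ.* (t ℚ.+ h) ^ k

-- Summing `expTerm-increment` over the degrees bounds the increment by `h` times the polynomial of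
-- one degree less. That polynomial is `expPoly k` without its top term, and the top term appears on
-- the left so that no predecessor of `k` occurs.
expPoly-increment : ∀ {t h} → 0ℚ ℚ.≤ t → 0ℚ ℚ.≤ h → ∀ k →
  expPoly k (t ℚ.+ h) ℚ.+ h ℚ.* expTerm k (t ℚ.+ h) ℚ.≤
  expPoly k t ℚ.+ h ℚ.* expPoly k (t ℚ.+ h)
expPoly-increment 0≤t 0≤h zero = ℚₚ.≤-refl
expPoly-increment {t} {h} 0≤t 0≤h (suc k) = begin
  (P s ℚ.+ τ′ s) ℚ.+ h ℚ.* τ′ s
    ≤⟨ ℚₚ.+-monoˡ-≤ (h ℚ.* τ′ s) (ℚₚ.+-monoʳ-≤ (P s) (expTerm-increment 0≤t 0≤h k)) ⟩
  (P s ℚ.+ (τ′ t ℚ.+ h ℚ.* τ s)) ℚ.+ h ℚ.* τ′ s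
    ≡⟨ solve 5 (λ Ps τ′t h τs τ′s →
         (Ps :+ (τ′t :+ h :* τs)) :+ h :* τ′s := (Ps :+ h :* τs) :+ (τ′t :+ h :* τ′s))
         refl (P s) (τ′ t) h (τ s) (τ′ s) ⟩
  (P s ℚ.+ h ℚ.* τ s) ℚ.+ (τ′ t ℚ.+ h ℚ.* τ′ s)
    ≤⟨ ℚₚ.+-monoˡ-≤ (τ′ t ℚ.+ h ℚ.* τ′ s) (expPoly-increment 0≤t 0≤h k) ⟩
  (P t ℚ.+ h ℚ.* P s) ℚ.+ (τ′ t ℚ.+ h ℚ.* τ′ s)
    ≡⟨ solve 5 (λ Pt h Ps τ′t τ′s →
         (Pt :+ h :* Ps) :+ (τ′t :+ h :* τ′s) := (Pt :+ τ′t) :+ h :* (Ps :+ τ′s))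
         refl (P t) h (P s) (τ′ t) (τ′ s) ⟩
  (P t ℚ.+ τ′ t) ℚ.+ h ℚ.* (P s ℚ.+ τ′ s) ∎
  where
  open ℚₚ.≤-Reasoning
  open +-*-Solver
  s = t ℚ.+ h
  P = expPoly k
  τ = expTerm k
  τ′ = expTerm (suc k)

expTerm-nonNeg : ∀ k {t} → 0ℚ ℚ.≤ t → 0ℚ ℚ.≤ expTerm k t
expTerm-nonNeg k 0≤t = *-nonNeg (^-nonNeg 0≤t k) (ℚₚ.<⇒≤ (0<1/! k))

expPoly-decay : ∀ {t h} → 0ℚ ℚ.≤ t → 0ℚ ℚ.≤ h → ∀ k →
  (1ℚ ℚ.- h) ℚ.* expPoly k (t ℚ.+ h) ℚ.≤ expPoly k t
expPoly-decay {t} {h} 0≤t 0≤h k = subst₂ ℚ._≤_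
  (solve 2 (λ h y → y :- h :* y := (con 1ℚ :- h) :* y) refl h (expPoly k s))
  (solve 2 (λ y z → y :+ z :- z := y) refl (expPoly k t) (h ℚ.* expPoly k s))
  (ℚₚ.+-monoˡ-≤ (ℚ.- (h ℚ.* expPoly k s)) (ℚₚ.≤-trans
    (+-≤ {expPoly k s} (*-nonNeg 0≤h (expTerm-nonNeg k (+-nonNeg 0≤t 0≤h))) refl)
    (expPoly-increment 0≤t 0≤h k)))
  where
  open +-*-Solver
  s = t ℚ.+ h

-- Each factor `1 − h` pays for lowering the argument by `h`, until the polynomial is evaluated at
-- 0, where it equals 1.
^-expPoly-≤1 : ∀ {h} → 0ℚ ℚ.≤ h → h ℚ.≤ 1ℚ → ∀ k j →
  (1ℚ ℚ.- h) ^ j ℚ.* expPoly k (j · h) ℚ.≤ 1ℚ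
^-expPoly-≤1 0≤h h≤1 k zero = ℚₚ.≤-reflexive
  (trans (ℚₚ.*-identityˡ (expPoly k 0ℚ)) (expPoly-0 k))
^-expPoly-≤1 {h} 0≤h h≤1 k (suc j) = begin
  (q ℚ.* q ^ j) ℚ.* expPoly k (h ℚ.+ j · h)
    ≡⟨ cong (λ s → (q ℚ.* q ^ j) ℚ.* expPoly k s) (ℚₚ.+-comm h (j · h)) ⟩
  (q ℚ.* q ^ j) ℚ.* expPoly k (j · h ℚ.+ h)
    ≡⟨ solve 3 (λ a b c → (a :* b) :* c := b :* (a :* c)) refl
         q (q ^ j) (expPoly k (j · h ℚ.+ h)) ⟩
  q ^ j ℚ.* (q ℚ.* expPoly k (j · h ℚ.+ h))
    ≤⟨ ≤-scaleˡ (q ^ j) (^-nonNeg (≤⇒0≤- h≤1) j) (expPoly-decay (·-nonNeg j 0≤h) 0≤h k) ⟩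
  q ^ j ℚ.* expPoly k (j · h)
    ≤⟨ ^-expPoly-≤1 0≤h h≤1 k j ⟩
  1ℚ ∎
  where
  open ℚₚ.≤-Reasoning
  open +-*-Solver
  q = 1ℚ ℚ.- h

^-eSum-≤1 : ∀ {p} n → 0ℚ ℚ.≤ p → p ℚ.≤ 1ℚ → n · p ≡ 1ℚ → ∀ k →
  (1ℚ ℚ.- p) ^ n ℚ.* eSum k ℚ.≤ 1ℚ
^-eSum-≤1 {p} n 0≤p p≤1 np≡1 k = subst (λ z → (1ℚ ℚ.- p) ^ n ℚ.* z ℚ.≤ 1ℚ)
  (trans (cong (expPoly k) np≡1) (expPoly-1 k)) (^-expPoly-≤1 0≤p p≤1 k n)

-- Probability that exactly one element of a set is active

isEmpty : ∀ {n} → Subset n → Bool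
isEmpty []            = true
isEmpty (inside ∷ D)  = false
isEmpty (outside ∷ D) = isEmpty D

-- A Boolean test by recursion on the subset, so that its `mass` unfolds one coordinate at a time.
isSingleton : ∀ {n} → Fin n → Subset n → Bool
isSingleton zero    (inside ∷ D)  = isEmpty D
isSingleton zero    (outside ∷ D) = false
isSingleton (suc i) (inside ∷ D)  = false
isSingleton (suc i) (outside ∷ D) = isSingleton i D

isEmpty⁺ : ∀ {n} (D : Subset n) → (∀ j → j ∉ D) → isEmpty D ≡ true
isEmpty⁺ []            _  = refl
isEmpty⁺ (inside ∷ D)  ∉D = contradiction here (∉D zero)
isEmpty⁺ (outside ∷ D) ∉D = isEmpty⁺ D λ j j∈D → ∉D (suc j) (there j∈D)

isSingleton⁺ : ∀ {n} {i : Fin n} {D} → i ∈ D → (∀ j → j ∈ D → j ≡ i) →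
               isSingleton i D ≡ true
isSingleton⁺ {D = inside ∷ D}  here        unique =
  isEmpty⁺ D λ j j∈D → contradiction (unique (suc j) (there j∈D)) λ ()
isSingleton⁺ {D = inside ∷ D}  (there i∈D) unique =
  contradiction (unique zero here) λ ()
isSingleton⁺ {D = outside ∷ D} (there i∈D) unique =
  isSingleton⁺ i∈D λ j j∈D → Finₚ.suc-injective (unique (suc j) (there j∈D))

-- The probability of E when each element is active with probability p; it is a
-- rational, hence independent of the index in the Cauchy sequences of Pr.
mass : ℚ → ∀ {n} → (Subset n → Bool) → ℚ
mass p {zero}  E = if E [] then 1ℚ else 0ℚ
mass p {suc n} E = p ℚ.* mass p (λ R → E (inside ∷ R)) ℚ.+
                   (1ℚ ℚ.- p) ℚ.* mass p (λ R → E (outside ∷ R))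

seq-∑-subsets : ∀ p k {n} (E : Subset n → Bool) →
  seq (∑-subsets λ R → if E R then prSet k (λ _ → const p) R else 0ℝ) k ≡ mass p E
seq-∑-subsets p k {zero}  E with E []
... | true  = refl
... | false = refl
seq-∑-subsets p k {suc n} E = cong₂ ℚ._+_
  (side (const p) (λ R → E (inside ∷ R)))
  (side (1ℝ - const p) (λ R → E (outside ∷ R)))
  where
  pr : Subset n → ℝ
  pr = prSet k (λ _ → const p)
  side : ∀ c (E′ : Subset n → Bool) →
    seq (∑-subsets λ R → if E′ R then c * pr R else 0ℝ) k ≡ seq c k ℚ.* mass p E′
  side c E′ = trans
    (∑-subsets-cong k
      {f = λ R → if E′ R then c * pr R else 0ℝ}
      {g = λ R → c * (if E′ R then pr R else 0ℝ)}
      λ R → scale-if k (E′ R) c (pr R))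
    (trans (∑-subsets-*ˡ k c (λ R → if E′ R then pr R else 0ℝ))
      (cong (seq c k ℚ.*_) (seq-∑-subsets p k E′)))

module _ {p : ℚ} (0≤p : 0ℚ ℚ.≤ p) (p≤1 : p ℚ.≤ 1ℚ) where

  mass-mono : ∀ {n} {E E′ : Subset n → Bool} →
    (∀ R → E R ≡ true → E′ R ≡ true) → mass p E ℚ.≤ mass p E′
  mass-mono {zero} {E} {E′} E⇒E′ with E [] in eq | E′ [] in eq′
  ... | false | false = ℚₚ.≤-refl
  ... | false | true  = ℚₚ.<⇒≤ 0<1
  ... | true  | true  = ℚₚ.≤-refl
  ... | true  | false with () ← trans (sym eq′) (E⇒E′ [] eq)
  mass-mono {suc n} E⇒E′ = ℚₚ.+-mono-≤
    (≤-scaleˡ p 0≤p (mass-mono λ R → E⇒E′ (inside ∷ R)))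
    (≤-scaleˡ (1ℚ ℚ.- p) (≤⇒0≤- p≤1) (mass-mono λ R → E⇒E′ (outside ∷ R)))

  mass-nonNeg : ∀ {n} (E : Subset n → Bool) → 0ℚ ℚ.≤ mass p E
  mass-nonNeg {zero} E with E []
  ... | true  = ℚₚ.<⇒≤ 0<1
  ... | false = ℚₚ.≤-refl
  mass-nonNeg {suc n} E = +-nonNeg
    (*-nonNeg 0≤p (mass-nonNeg {n} _))
    (*-nonNeg (≤⇒0≤- p≤1) (mass-nonNeg {n} _))

module _ (p : ℚ) where

  private
    q = 1ℚ ℚ.- p

  mass-false : ∀ n → mass p {n} (λ _ → false) ≡ 0ℚ
  mass-false zero    = refl
  mass-false (suc n) = trans
    (cong₂ ℚ._+_ (cong (p ℚ.*_) (mass-false n)) (cong (q ℚ.*_) (mass-false n)))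
    (cong₂ ℚ._+_ (ℚₚ.*-zeroʳ p) (ℚₚ.*-zeroʳ q))

  mass-isEmpty : ∀ {n} (T : Subset n) → mass p (λ R → isEmpty (T ∩ R)) ≡ q ^ ∣ T ∣
  mass-isEmpty []            = refl
  mass-isEmpty {suc n} (inside ∷ T) = trans
    (cong₂ ℚ._+_ (trans (cong (p ℚ.*_) (mass-false n)) (ℚₚ.*-zeroʳ p))
                 (cong (q ℚ.*_) (mass-isEmpty T)))
    (ℚₚ.+-identityˡ _)
  -- `complement` sits in a module with a sequence index as parameter; `0` is a default value for
  -- it.
  mass-isEmpty (outside ∷ T) = trans (complement 0 p _) (mass-isEmpty T)

  -- The closed form t p q^(t − 1) is exactlyOne-suc.
  exactlyOne : ℕ → ℚ
  exactlyOne zero    = 0ℚ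
  exactlyOne (suc t) = p ℚ.* q ^ t ℚ.+ q ℚ.* exactlyOne t

  singletonMass : ∀ {n} → Subset n → Fin n → ℚ
  singletonMass T i = mass p λ R → isSingleton i (T ∩ R)

  -- The events `T ∩ R = {i}` are disjoint for distinct `i`. If the first element lies in `T`, its
  -- own event has mass `p q^t` for the `t` remaining elements of `T`, and every other event
  -- requires it to be inactive, a factor `q`. If it lies outside `T`, its state does not matter.
  sum-singletonMass : ∀ {n} (T : Subset n) → sum (singletonMass T) ≡ exactlyOne ∣ T ∣
  sum-singletonMass []                    = refl
  sum-singletonMass {suc n} (inside ∷ T)  = cong₂ ℚ._+_
    (trans (cong₂ ℚ._+_ (cong (p ℚ.*_) (mass-isEmpty T))
                        (trans (cong (q ℚ.*_) (mass-false n)) (ℚₚ.*-zeroʳ q)))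
           (ℚₚ.+-identityʳ (p ℚ.* q ^ ∣ T ∣)))
    (trans (sum-cong-≗ {x = λ i → singletonMass (inside ∷ T) (suc i)} shift)
      (trans (sym (*-distribˡ-sum q (singletonMass T)))
             (cong (q ℚ.*_) (sum-singletonMass T))))
    where
    shift : ∀ i → singletonMass (inside ∷ T) (suc i) ≡ q ℚ.* singletonMass T i
    shift i = trans
      (cong (ℚ._+ q ℚ.* singletonMass T i)
        (trans (cong (p ℚ.*_) (mass-false n)) (ℚₚ.*-zeroʳ p)))
      (ℚₚ.+-identityˡ (q ℚ.* singletonMass T i))
  sum-singletonMass {suc n} (outside ∷ T) = trans
    (cong₂ ℚ._+_ (mass-false (suc n))
      (sum-cong-≗ {x = λ i → singletonMass (outside ∷ T) (suc i)} {y = singletonMass T}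
        λ i → complement 0 p (singletonMass T i)))
    (trans (ℚₚ.+-identityˡ (sum (singletonMass T))) (sum-singletonMass T))

  exactlyOne-suc : ∀ t → exactlyOne (suc t) ≡ (suc t · p) ℚ.* q ^ t
  exactlyOne-suc zero    = solve 1 (λ p →
    p :* con 1ℚ :+ (con 1ℚ :- p) :* con 0ℚ := (p :+ con 0ℚ) :* con 1ℚ) refl p
    where open +-*-Solver
  exactlyOne-suc (suc t) = trans
    (cong (λ z → p ℚ.* q ^ suc t ℚ.+ q ℚ.* z) (exactlyOne-suc t))
    (solve 4 (λ p q y a →
      p :* (q :* y) :+ q :* (a :* y) := (p :+ a) :* (q :* y)) refl p q (q ^ t) (suc t · p))
    where open +-*-Solver

  module _ (0≤p : 0ℚ ℚ.≤ p) (p≤1 : p ℚ.≤ 1ℚ) where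

    -- By the closed form, passing from `t + 1` to `t + 2` adds `p q^t (1 − (t + 2) p)`, which is
    -- nonnegative while `(t + 2) p ≤ 1`.
    exactlyOne-step : ∀ t → suc t · p ℚ.≤ 1ℚ → exactlyOne t ℚ.≤ exactlyOne (suc t)
    exactlyOne-step zero    _ = +-nonNeg (*-nonNeg 0≤p (ℚₚ.<⇒≤ 0<1))
                                         (*-nonNeg (≤⇒0≤- p≤1) ℚₚ.≤-refl)
    exactlyOne-step (suc t) h = subst₂ ℚ._≤_
      (sym (exactlyOne-suc t)) (sym (exactlyOne-suc (suc t)))
      (+-≤ {(suc t · p) ℚ.* q ^ t}
        (*-nonNeg (*-nonNeg 0≤p (^-nonNeg (≤⇒0≤- p≤1) t)) (≤⇒0≤- h))
        (solve 3 (λ p y a →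
           a :* y :+ (p :* y) :* (con 1ℚ :- (p :+ a)) :=
           (p :+ a) :* ((con 1ℚ :- p) :* y)) refl p (q ^ t) (suc t · p)))
      where open +-*-Solver

    ·-monoˡ : ∀ {s t} → s ℕ.≤ t → s · p ℚ.≤ t · p
    ·-monoˡ {t = t} ℕ.z≤n     = ·-nonNeg t 0≤p
    ·-monoˡ         (ℕ.s≤s h) = ℚₚ.+-monoʳ-≤ p (·-monoˡ h)

    exactlyOne-mono : ∀ {s n} → n · p ℚ.≤ 1ℚ → s ℕ.≤ n → exactlyOne s ℚ.≤ exactlyOne n
    exactlyOne-mono {n = zero}  np≤1 ℕ.z≤n = ℚₚ.≤-refl
    exactlyOne-mono {n = suc n} np≤1 s≤1+n with ℕₚ.m≤n⇒m<n∨m≡n s≤1+n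
    ... | inj₂ refl        = ℚₚ.≤-refl
    ... | inj₁ (ℕ.s≤s s≤n) = ℚₚ.≤-trans
      (exactlyOne-mono (ℚₚ.≤-trans (·-monoˡ (ℕₚ.n≤1+n n)) np≤1) s≤n)
      (exactlyOne-step n np≤1)

-- Greedy selection and the arrival order that blocks an element

foldl-preserves : ∀ {A B : Set} (P : A → Set) {f : A → B → A} →
  (∀ a b → P a → P (f a b)) → ∀ {a} bs → P a → P (foldl f a bs)
foldl-preserves P pres []       Pa = Pa
foldl-preserves P pres (b ∷ bs) Pa = foldl-preserves P pres bs (pres _ b Pa)

feasible-unique : ∀ {n} {S : Subset n} {i j} → ∣ S ∣ ℕ.≤ 1 → i ∈ S → j ∈ S → i ≡ j
feasible-unique {S = S} {i} {j} ∣S∣≤1 i∈S j∈S with i Finₚ.≟ j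
... | yes i≡j = i≡j
... | no  i≢j = contradiction
  (subst (ℕ._< ∣ S ∣) (Subsetₚ.∣⁅x⁆∣≡1 j) (Subsetₚ.p⊂q⇒∣p∣<∣q∣
    ( (λ x∈ → subst (_∈ S) (sym (Subsetₚ.x∈⁅y⁆⇒x≡y j x∈)) j∈S)
    , i , i∈S , Subsetₚ.x≢y⇒x∉⁅y⁆ i≢j)))
  (ℕₚ.≤⇒≯ ∣S∣≤1)

module _ {m : ℕ} (F : DownClosedFamily (suc m)) where

  isAdmitted : Fin (suc m) → Bool
  isAdmitted i = member F ⁅ i ⁆

  -- The set T of the opening comment.
  admitted : Subset (suc m)
  admitted = Vec.tabulate isAdmitted

  ∈-admitted⁺ : ∀ {i} → T (member F ⁅ i ⁆) → i ∈ admitted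
  ∈-admitted⁺ {i} h = Vecₚ.lookup⇒[]= i admitted
    (trans (Vecₚ.lookup∘tabulate isAdmitted i) (Equivalence.to Boolₚ.T-≡ h))

  ∈-admitted⁻ : ∀ {i} → i ∈ admitted → member F ⁅ i ⁆ ≡ true
  ∈-admitted⁻ {i} i∈ = trans (sym (Vecₚ.lookup∘tabulate isAdmitted i)) (Vecₚ.[]=⇒lookup i∈)

  member⇒admitted : ∀ {S i} → T (member F S) → i ∈ S → i ∈ admitted
  member⇒admitted {S} {i} S∈F i∈S = ∈-admitted⁺ (downClosed F ⁅ i ⁆ S
    (λ x∈ → subst (_∈ S) (sym (Subsetₚ.x∈⁅y⁆⇒x≡y i x∈)) i∈S) S∈F)

  -- The selected set changes only when the enlarged set lies in the family, so an invariant has to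
  -- be checked in that case alone, with the membership at hand.
  step-preserves : ∀ (P : Subset (suc m) → Set) R →
    (∀ S a → P S → T (member F (S ∪ ⁅ a ⁆)) → P (S ∪ ⁅ a ⁆)) →
    ∀ S a → P S → P (step F R S a)
  step-preserves P R pres S a PS with lookup R a | member F (S ∪ ⁅ a ⁆) in eq
  ... | false | _     = PS
  ... | true  | false = PS
  ... | true  | true  = pres S a PS (subst T (sym eq) tt)

  selected⇒admitted : ∀ R π {i} → i ∈ selected F R π → i ∈ admitted
  selected⇒admitted R π {i} = foldl-preserves (λ S → i ∈ S → i ∈ admitted)
    (step-preserves (λ S → i ∈ S → i ∈ admitted) R
      λ S a _ S∪a∈F i∈ → member⇒admitted S∪a∈F i∈)
    (map (π ⟨$⟩ʳ_) (allFin (suc m))) (λ i∈⊥ → contradiction i∈⊥ Subsetₚ.∉⊥)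

  -- With `j` at the head of the order, the first step leads from `⊥` to `⁅ j ⁆`. Every later
  -- enlargement is feasible and contains `j`, so it cannot contain `i`.
  firstArrival-blocks : ∀ R {i j} → j ≢ i → j ∈ admitted → j ∈ R →
                        i ∉ selected F R (Perm.transpose zero j)
  firstArrival-blocks R {i} {j} j≢i j∈T j∈R = proj₂ (foldl-preserves Blocked
    (step-preserves Blocked R λ S a (j∈S , i∉S) S∪a∈F →
      let j∈S∪a = Subsetₚ.p⊆p∪q ⁅ a ⁆ j∈S
      in j∈S∪a , λ i∈S∪a → j≢i (feasible-unique (feasible F _ S∪a∈F) j∈S∪a i∈S∪a))
    (map (Perm.transpose zero j ⟨$⟩ʳ_) (tabulate suc))
    (subst Blocked (sym first)
      (Subsetₚ.x∈⁅x⁆ j , λ i∈ → j≢i (sym (Subsetₚ.x∈⁅y⁆⇒x≡y j i∈)))))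
    where
    Blocked : Subset (suc m) → Set
    Blocked S = j ∈ S × i ∉ S
    first : step F R ⊥ j ≡ ⁅ j ⁆
    first rewrite Vecₚ.[]=⇒lookup j∈R | Subsetₚ.∪-identityˡ ⁅ j ⁆
      | ∈-admitted⁻ j∈T = refl

  rivals : ∀ i R → Dec (∃[ j ] (j ≢ i × j ∈ (admitted ∩ R)))
  rivals i R = Finₚ.any? λ j → ¬? (j Finₚ.≟ i) ×-dec (j Subsetₚ.∈? (admitted ∩ R))

  rivalFirst : Fin (suc m) → Subset (suc m) → Permutation′ (suc m)
  rivalFirst i R with rivals i R
  ... | yes (j , _) = Perm.transpose zero j
  -- Without a rival every order gives the same bound; the identity is a default.
  ... | no  _       = Perm.id

  rivalFirst-selects : ∀ i R →
    (lookup (selected F R (rivalFirst i R)) i ∧ lookup R i) ≡ true →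
    isSingleton i (admitted ∩ R) ≡ true
  rivalFirst-selects i R hit with rivals i R
  ... | yes (j , j≢i , j∈T∩R) =
    let j∈T , j∈R = Subsetₚ.x∈p∩q⁻ admitted R j∈T∩R
    in contradiction (Vecₚ.lookup⇒[]= i _ (Boolₚ.∧-conicalˡ _ _ hit))
         (firstArrival-blocks R j≢i j∈T j∈R)
  ... | no alone = isSingleton⁺
    (Subsetₚ.x∈p∩q⁺
      ( selected⇒admitted R Perm.id (Vecₚ.lookup⇒[]= i _ (Boolₚ.∧-conicalˡ _ _ hit))
      , Vecₚ.lookup⇒[]= i R (Boolₚ.∧-conicalʳ _ _ hit)))
    λ j j∈ → decidable-stable (j Finₚ.≟ i) λ j≢i → alone (j , j≢i , j∈)

-- Late indices of Cauchy sequences, finite sums and reciprocals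

Eventually : (ℕ → Set) → Set
Eventually P = ∃[ N ] (∀ k → N ℕ.≤ k → P k)

eventually-× : ∀ {P Q : ℕ → Set} → Eventually P → Eventually Q →
               Eventually (λ k → P k × Q k)
eventually-× (M , p) (N , q) = M ℕ.⊔ N , λ k ≤k →
  p k (ℕₚ.m⊔n≤o⇒m≤o M N ≤k) , q k (ℕₚ.m⊔n≤o⇒n≤o M N ≤k)

eventually-∀ : ∀ {m} {P : Fin m → ℕ → Set} → (∀ i → Eventually (P i)) →
               Eventually (λ k → ∀ i → P i k)
eventually-∀ {zero}          _  = 0 , λ _ _ ()
eventually-∀ {suc m} {P} ev with eventually-× (ev zero) 
  (eventually-∀ {P = λ i → P (suc i)} λ i → ev (suc i))
... | N , both = N , λ where
  k N≤k zero    → proj₁ (both k N≤k)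
  k N≤k (suc i) → proj₂ (both k N≤k) i

sum-mono : ∀ {n} {f g : Fin n → ℚ} → (∀ i → f i ℚ.≤ g i) → sum f ℚ.≤ sum g
sum-mono {zero}  _   = ℚₚ.≤-refl
sum-mono {suc n} f≤g = ℚₚ.+-mono-≤ (f≤g zero) (sum-mono λ i → f≤g (suc i))

sum-nonNeg : ∀ {n} {f : Fin n → ℚ} → (∀ i → 0ℚ ℚ.≤ f i) → 0ℚ ℚ.≤ sum f
sum-nonNeg {zero}  _   = ℚₚ.≤-refl
sum-nonNeg {suc n} 0≤f = +-nonNeg (0≤f zero) (sum-nonNeg λ i → 0≤f (suc i))

seq-∑ : ∀ {n} (f : Fin n → ℝ) k → seq (∑ f) k ≡ sum (λ i → seq (f i) k)
seq-∑ {zero}  f k = refl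
seq-∑ {suc n} f k = cong (seq (f zero) k ℚ.+_) (seq-∑ (λ i → f (suc i)) k)

≤-seq-inv : ∀ {c} (x : ℝ) (0<x : 0ℝ < x) k →
  c ℚ.* (proj₁ 0<x ℚ.⊔ seq x k) ℚ.≤ 1ℚ → c ℚ.≤ seq (inv x 0<x) k
≤-seq-inv x (κ , 0<κ , _) k h = ℚₚ.*-cancelʳ-≤-pos D {{D>0}}
  (ℚₚ.≤-trans h (ℚₚ.≤-reflexive (sym (trans (ℚₚ.*-comm _ D) (recip-inverse D D>0)))))
  where
  D = κ ℚ.⊔ seq x k
  D>0 : ℚ.Positive D
  D>0 = ⊔-pos (seq x k) 0<κ

-- Truncation in `inv` replaces the denominator by `D ≥ seq x k`. As `c` is nonnegative, this only
-- strengthens the hypothesis, so the denominator can be cleared at every index.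
≤-seq-*-inv : ∀ {c} (y x : ℝ) (0<x : 0ℝ < x) k → 0ℚ ℚ.≤ c →
  c ℚ.≤ seq (y * inv x 0<x) k → c ℚ.* seq x k ℚ.≤ seq y k
≤-seq-*-inv {c} y x (κ , 0<κ , _) k 0≤c h = begin
  c ℚ.* seq x k              ≤⟨ ≤-scaleˡ c 0≤c (ℚₚ.p≤q⊔p κ (seq x k)) ⟩
  c ℚ.* D                    ≤⟨ ℚₚ.*-monoʳ-≤-nonNeg D {{ℚₚ.pos⇒nonNeg D {{D>0}}}} h ⟩
  seq y k ℚ.* recip D D>0 ℚ.* D
    ≡⟨ ℚₚ.*-assoc (seq y k) (recip D D>0) D ⟩
  seq y k ℚ.* (recip D D>0 ℚ.* D)
    ≡⟨ cong (seq y k ℚ.*_) (trans (ℚₚ.*-comm (recip D D>0) D) (recip-inverse D D>0)) ⟩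
  seq y k ℚ.* 1ℚ             ≡⟨ ℚₚ.*-identityʳ (seq y k) ⟩
  seq y k ∎
  where
  open ℚₚ.≤-Reasoning
  D = κ ℚ.⊔ seq x k
  D>0 : ℚ.Positive D
  D>0 = ⊔-pos (seq x k) 0<κ

-- The uniform instance and averaging over its elements

const-mono : ∀ {a b} → a ℚ.≤ b → const a ≤ const b
const-mono {a} {b} a≤b δ 0<δ = 0 , λ _ _ →
  ℚₚ.≤-trans a≤b (+-≤ (ℚₚ.<⇒≤ 0<δ) refl)

uniform : ∀ n p → 0ℚ ℚ.≤ p → p ℚ.≤ 1ℚ → n · p ≡ 1ℚ → 𝒫 n
uniform n p 0≤p p≤1 np≡1 = record
  { coord    = λ _ → const p
  ; coord≥0  = λ _ → const-mono 0≤p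
  ; coord≤1  = λ _ → const-mono p≤1
  ; ∑coord≤1 = λ δ 0<δ → 0 , λ k _ → ℚₚ.≤-trans
      (ℚₚ.≤-reflexive (trans (seq-∑ {n} (λ _ → const p) k) (trans (sum-replicate n) np≡1)))
      (+-≤ (ℚₚ.<⇒≤ 0<δ) refl)
  }

-- Double counting: adding the last hypothesis over all `i` gives `z * sum w` on the left because
-- `n · p ≡ 1`, and exchanging the sums on the right exposes the total over `i` for each seed, at
-- most `c`. A weight may be as low as `−η`, which costs at most `η` per seed.
average-bound : ∀ {n s} p z c η (w : Fin s → ℚ) (g : Fin n → Fin s → ℚ) →
  n · p ≡ 1ℚ → c ℚ.≤ 1ℚ → 0ℚ ℚ.≤ η →
  (∀ ω → 0ℚ ℚ.≤ w ω ℚ.+ η) → (∀ i ω → 0ℚ ℚ.≤ g i ω) →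
  (∀ ω → sum (λ i → g i ω) ℚ.≤ c) →
  (∀ i → z ℚ.* (sum w ℚ.* p) ℚ.≤ sum (λ ω → w ω ℚ.* g i ω)) →
  z ℚ.* sum w ℚ.≤ sum w ℚ.* c ℚ.+ s · η
average-bound {n} {s} p z c η w g np≡1 c≤1 0≤η 0≤w+η 0≤g G≤c h = begin
  z ℚ.* sum w
    ≡⟨ sym (trans (sym (×-comm-* n (z ℚ.* sum w) p))
         (trans (cong (z ℚ.* sum w ℚ.*_) np≡1) (ℚₚ.*-identityʳ (z ℚ.* sum w)))) ⟩
  n · (z ℚ.* sum w ℚ.* p)
    ≡⟨ sym (sum-replicate n) ⟩
  sum {n} (λ _ → z ℚ.* sum w ℚ.* p)
    ≤⟨ sum-mono (λ i → ℚₚ.≤-trans (ℚₚ.≤-reflexive (ℚₚ.*-assoc z (sum w) p)) (h i)) ⟩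
  sum (λ i → sum (λ ω → w ω ℚ.* g i ω))
    ≡⟨ ∑-comm (λ i ω → w ω ℚ.* g i ω) ⟩
  sum (λ ω → sum (λ i → w ω ℚ.* g i ω))
    ≡⟨ sum-cong-≗ (λ ω → sym (*-distribˡ-sum (w ω) (λ i → g i ω))) ⟩
  sum (λ ω → w ω ℚ.* G ω)
    ≤⟨ sum-mono each ⟩
  sum (λ ω → w ω ℚ.* c ℚ.+ η)
    ≡⟨ ∑-distrib-+ (λ ω → w ω ℚ.* c) (λ _ → η) ⟩
  sum (λ ω → w ω ℚ.* c) ℚ.+ sum {s} (λ _ → η)
    ≡⟨ cong₂ ℚ._+_ (sym (*-distribʳ-sum c w)) (sum-replicate s) ⟩
  sum w ℚ.* c ℚ.+ s · η ∎
  where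
  open ℚₚ.≤-Reasoning
  open +-*-Solver
  G : Fin s → ℚ
  G ω = sum (λ i → g i ω)
  each : ∀ ω → w ω ℚ.* G ω ℚ.≤ w ω ℚ.* c ℚ.+ η
  -- The difference `w (c − G) + η` equals `(w + η)(c − G) + η (1 − c + G)`, where every factor is
  -- nonnegative.
  each ω = +-≤ {w ω ℚ.* G ω}
    (+-nonNeg (*-nonNeg (0≤w+η ω) (≤⇒0≤- (G≤c ω)))
      (*-nonNeg 0≤η (+-nonNeg (≤⇒0≤- c≤1) (sum-nonNeg λ i → 0≤g i ω))))
    (solve 4 (λ w G c η →
      w :* G :+ ((w :+ η) :* (c :- G) :+ η :* ((con 1ℚ :- c) :+ G)) := w :* c :+ η)
      refl (w ω) (G ω) c η)

^-≤1 : ∀ {a} → 0ℚ ℚ.≤ a → a ℚ.≤ 1ℚ → ∀ j → a ^ j ℚ.≤ 1ℚ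
^-≤1 0≤a a≤1 zero    = ℚₚ.≤-refl
^-≤1 0≤a a≤1 (suc j) = ℚₚ.≤-trans
  (*-mono 0≤a (ℚₚ.<⇒≤ 0<1) a≤1 (^-≤1 0≤a a≤1 j)) (ℚₚ.≤-reflexive (ℚₚ.*-identityˡ 1ℚ))

seq-Pr : ∀ {n p} (x : 𝒫 n) → coord x ≡ (λ _ → const p) → ∀ (F : RandomFamily n) E k →
  seq (Pr x F E) k ≡ sum (λ ω → seq (weight F ω) k ℚ.* mass p (E ω))
-- Opening the record turns `coord x` into a variable, so the equation can be matched with `refl`.
seq-Pr {p = p} record { coord = _ } refl F E k = trans
  (seq-∑ (λ ω → weight F ω *
    ∑-subsets λ R → if E ω R then prSet k (λ _ → const p) R else 0ℝ) k)
  (sum-cong-≗ λ ω → cong (seq (weight F ω) k ℚ.*_) (seq-∑-subsets p k (E ω)))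

-- The bound on the guarantee at a fixed index

module _ {m : ℕ} {p : ℚ} (0≤p : 0ℚ ℚ.≤ p) (p≤1 : p ℚ.≤ 1ℚ) (np≡1 : suc m · p ≡ 1ℚ) where

  private
    q = 1ℚ ℚ.- p

    0≤q : 0ℚ ℚ.≤ q
    0≤q = ≤⇒0≤- p≤1

    q≤1 : q ℚ.≤ 1ℚ
    q≤1 = +-≤ {q} 0≤p (solve 1 (λ p → con 1ℚ :- p :+ p := con 1ℚ) refl p)
      where open +-*-Solver

  q^n≤1/e : ∀ k → q ^ suc m ℚ.≤ seq 1/e k
  q^n≤1/e k = ≤-seq-inv e 0<e k
    (subst (λ z → q ^ suc m ℚ.* z ℚ.≤ 1ℚ)
      -- The truncation constant in `0<e` is 1 and every partial sum is at least `eSum 0`, which is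
      -- 1; hence the maximum in `inv` is `eSum k` itself.
      (sym (ℚₚ.p≤q⇒p⊔q≡q (proj₁ (eSum-bounds {0} {k} ℕ.z≤n))))
      (^-eSum-≤1 (suc m) 0≤p p≤1 np≡1 k))

  -- The two powers differ by `p q^m`, and `q^m ≤ 1`.
  q^m≤q^n+p : q ^ m ℚ.≤ q ^ suc m ℚ.+ p
  q^m≤q^n+p = +-≤ {q ^ m} (*-nonNeg 0≤p (≤⇒0≤- (^-≤1 0≤q q≤1 m)))
    (solve 2 (λ p y → y :+ p :* (con 1ℚ :- y) := (con 1ℚ :- p) :* y :+ p) refl p (q ^ m))
    where open +-*-Solver

  module _ (F : RandomFamily (suc m)) where

    -- There is one adversary per element. A guarantee against all adversaries covers each of them,
    -- so the resulting bounds may be added although the arrival orders differ.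
    rivalFirstAdversary : Fin (suc m) → Adversary F
    rivalFirstAdversary i ω = rivalFirst (family F ω) i

    won : Fin (suc m) → Event F
    won i ω R = selects F (rivalFirstAdversary i) i ω R ∧ active F i ω R

    sum-mass-won : ∀ ω → sum (λ i → mass p (won i ω)) ℚ.≤ q ^ m
    sum-mass-won ω = begin
      sum (λ i → mass p (won i ω))
        ≤⟨ sum-mono (λ i → mass-mono 0≤p p≤1 (rivalFirst-selects (family F ω) i)) ⟩
      sum (singletonMass p S)
        ≡⟨ sum-singletonMass p S ⟩
      exactlyOne p ∣ S ∣
        ≤⟨ exactlyOne-mono p 0≤p p≤1 (ℚₚ.≤-reflexive np≡1) (Subsetₚ.∣p∣≤n S) ⟩
      exactlyOne p (suc m)
        ≡⟨ exactlyOne-suc p m ⟩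
      (suc m · p) ℚ.* q ^ m
        ≡⟨ trans (cong (ℚ._* q ^ m) np≡1) (ℚₚ.*-identityˡ (q ^ m)) ⟩
      q ^ m ∎
      where
      open ℚₚ.≤-Reasoning
      S = admitted (family F ω)

    rivalFirst-bound : ∀ {z η} → 0ℚ ℚ.≤ z → 0ℚ ℚ.≤ η → ∀ k →
      (∀ ω → 0ℚ ℚ.≤ seq (weight F ω) k ℚ.+ η) →
      (x : 𝒫 (suc m)) → coord x ≡ (λ _ → const p) →
      (x>0 : ∀ i → 0ℝ < coord x i) →
      (∀ i → z ℚ.≤ seq (prSelectedGivenActive x F (rivalFirstAdversary i) i (x>0 i)) k) →
      z ℚ.* seq (∑ (weight F)) k ℚ.≤
      seq (∑ (weight F)) k ℚ.* q ^ m ℚ.+ seeds F · η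
    rivalFirst-bound {z} {η} 0≤z 0≤η k 0≤w+η x x≡p x>0 h =
      subst (λ W → z ℚ.* W ℚ.≤ W ℚ.* q ^ m ℚ.+ seeds F · η) (sym (seq-∑ (weight F) k))
        (average-bound p z (q ^ m) η (λ ω → seq (weight F ω) k) (λ i ω → mass p (won i ω))
          np≡1 (^-≤1 0≤q q≤1 m) 0≤η 0≤w+η (λ i ω → mass-nonNeg 0≤p p≤1 (won i ω))
          sum-mass-won each)
      where
      each : ∀ i → z ℚ.* (sum (λ ω → seq (weight F ω) k) ℚ.* p) ℚ.≤
                   sum (λ ω → seq (weight F ω) k ℚ.* mass p (won i ω))
      each i = subst₂ (λ a b → z ℚ.* a ℚ.≤ b)
        (trans (Pr-active k x F i) (cong₂ ℚ._*_ (seq-∑ (weight F) k)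
          (cong (λ f → seq (f i) k) x≡p)))
        (seq-Pr x x≡p F (won i) k)
        (≤-seq-*-inv (Pr x F (won i)) (Pr x F (active F i)) (active-pos x F i (x>0 i)) k 0≤z (h i))

-- Choice of the slack and the contradiction

·-small : ∀ s δ → 0ℚ ℚ.< δ → ∃[ η ] (0ℚ ℚ.< η × s · η ℚ.≤ δ)
·-small s δ 0<δ = go (scale (s · 1ℚ) 0ℚ δ (·-nonNeg s (ℚₚ.<⇒≤ 0<1)) ℚₚ.≤-refl 0<δ)
  where
  absorb : ∀ η → (s · 1ℚ ℚ.+ 0ℚ) ℚ.* η ≡ s · η
  absorb η = trans (cong (ℚ._* η) (ℚₚ.+-identityʳ (s · 1ℚ)))
    (trans (×-assoc-* s 1ℚ η) (cong (s ·_) (ℚₚ.*-identityˡ η)))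
  go : ∃[ η ] (0ℚ ℚ.< η × (s · 1ℚ ℚ.+ 0ℚ) ℚ.* η ℚ.≤ δ) →
       ∃[ η ] (0ℚ ℚ.< η × s · η ℚ.≤ δ)
  go (η , 0<η , small) = η , 0<η , subst (ℚ._≤ δ) (absorb η) small

-- Inserting `c ≤ r + γ` into the negated inequality would leave `γ W ≤ τ`, whereas `W` is at least
-- 1/2 and `τ` at most `γ/4`.
no-gap : ∀ {r c W τ γ} → 0ℚ ℚ.< γ → c ℚ.≤ r ℚ.+ γ → 1ℚ ℚ.≤ W ℚ.+ ½ →
  τ ℚ.≤ ½ ℚ.* (½ ℚ.* γ) → ¬ ((r ℚ.+ (γ ℚ.+ γ)) ℚ.* W ℚ.≤ W ℚ.* c ℚ.+ τ)
no-gap {r} {c} {W} {τ} {γ} 0<γ c≤r+γ 1≤W+½ τ≤ h =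
  ℚₚ.<-irrefl refl (ℚₚ.<-≤-trans half<γ/2 γ/2≤half)
  where
  open ℚₚ.≤-Reasoning
  open +-*-Solver
  half = ½ ℚ.* (½ ℚ.* γ)
  half<γ/2 : half ℚ.< ½ ℚ.* γ
  half<γ/2 = subst₂ ℚ._<_ (ℚₚ.+-identityʳ half) (½+½ (½ ℚ.* γ))
    (ℚₚ.+-monoʳ-< half (*-pos 0<½ (*-pos 0<½ 0<γ)))
  ½≤W : ½ ℚ.≤ W
  ½≤W = subst (½ ℚ.≤_) (solve 2 (λ w h → w :+ h :- h := w) refl W ½)
    (ℚₚ.+-monoˡ-≤ (ℚ.- ½) 1≤W+½)
  γ/2≤half : ½ ℚ.* γ ℚ.≤ half
  γ/2≤half = begin
    ½ ℚ.* γ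
      ≤⟨ ℚₚ.*-monoʳ-≤-nonNeg γ {{ℚ.nonNegative (ℚₚ.<⇒≤ 0<γ)}} ½≤W ⟩
    W ℚ.* γ
      ≡⟨ solve 3 (λ r γ W → W :* γ := (r :+ (γ :+ γ)) :* W :- W :* (r :+ γ)) refl r γ W ⟩
    (r ℚ.+ (γ ℚ.+ γ)) ℚ.* W ℚ.- W ℚ.* (r ℚ.+ γ)
      ≤⟨ ℚₚ.+-monoˡ-≤ (ℚ.- (W ℚ.* (r ℚ.+ γ))) (ℚₚ.≤-trans h (ℚₚ.+-mono-≤
           (≤-scaleˡ W (ℚₚ.≤-trans (ℚₚ.<⇒≤ 0<½) ½≤W) c≤r+γ) τ≤)) ⟩
    W ℚ.* (r ℚ.+ γ) ℚ.+ half ℚ.- W ℚ.* (r ℚ.+ γ)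
      ≡⟨ solve 2 (λ a b → a :+ b :- a := b) refl (W ℚ.* (r ℚ.+ γ)) half ⟩
    half ∎

drop-slack : ∀ {r u ε y β} → r ℚ.≤ u → 0ℚ ℚ.+ (β ℚ.+ β) ℚ.≤ ε → u ℚ.+ ε ℚ.≤ y ℚ.+ β →
             r ℚ.+ β ℚ.≤ y
drop-slack {r} {u} {ε} {y} {β} r≤u 2β≤ε h = subst₂ ℚ._≤_
  (solve 2 (λ r β → r :+ (con 0ℚ :+ (β :+ β)) :- β := r :+ β) refl r β)
  (solve 2 (λ y β → y :+ β :- β := y) refl y β)
  (ℚₚ.+-monoˡ-≤ (ℚ.- β) (ℚₚ.≤-trans (ℚₚ.+-mono-≤ r≤u 2β≤ε) h))
  where open +-*-Solver

-- Everything is compared at a single late index of the Cauchy sequences, where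
-- the weights may be slightly negative and need not sum to exactly 1; the
-- slack η is chosen after the number of seeds is known.
guarantee-fails : ∀ {ε γ m p} → 0ℚ ℚ.< γ →
  Eventually (λ k → 0ℚ ℚ.+ ((γ ℚ.+ γ) ℚ.+ (γ ℚ.+ γ)) ℚ.≤ seq ε k) →
  0ℚ ℚ.≤ p → p ℚ.≤ 1ℚ → p ℚ.≤ γ → suc m · p ≡ 1ℚ →
  (x : 𝒫 (suc m)) → coord x ≡ (λ _ → const p) → (x>0 : ∀ i → 0ℝ < coord x i) →
  (F : RandomFamily (suc m)) →
  ¬ (∀ i adv → 1/e + ε ≤ prSelectedGivenActive x F adv i (x>0 i))
guarantee-fails {ε} {γ} {m} {p} 0<γ ε-large 0≤p p≤1 p≤γ np≡1 x x≡p x>0 F good =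
  fails (·-small (seeds F) (½ ℚ.* (½ ℚ.* γ)) (*-pos 0<½ (*-pos 0<½ 0<γ)))
  where
  q β : ℚ
  q = 1ℚ ℚ.- p
  -- Eventually `ε` is at least `2β`. One `β` absorbs the slack of the real inequality at a single
  -- index. Of the other, one `γ` covers the gap `p` between `q ^ m` and `q ^ suc m`, and one `γ`
  -- outweighs the errors in the weights.
  β = γ ℚ.+ γ
  0<β : 0ℚ ℚ.< β
  0<β = ℚₚ.+-mono-< 0<γ 0<γ
  adv : Fin (suc m) → Adversary F
  adv = rivalFirstAdversary 0≤p p≤1 np≡1 F
  y : Fin (suc m) → ℝ
  y i = prSelectedGivenActive x F (adv i) i (x>0 i)
  W : ℕ → ℚ
  W k = seq (∑ (weight F)) k
  Light : ℚ → Fin (seeds F) → ℕ → Set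
  Light η ω k = 0ℚ ℚ.≤ seq (weight F ω) k ℚ.+ η
  Selects : Fin (suc m) → ℕ → Set
  Selects i k = seq 1/e k ℚ.+ seq ε k ℚ.≤ seq (y i) k ℚ.+ β
  selects-eventually : ∀ i → Eventually (Selects i)
  selects-eventually i = good i (adv i) β 0<β
  At : ℚ → ℕ → Set
  At η k = (0ℚ ℚ.+ (β ℚ.+ β) ℚ.≤ seq ε k × 1ℚ ℚ.≤ W k ℚ.+ ½) ×
           (∀ ω → Light η ω k) × (∀ i → Selects i k)
  eventually : ∀ η → 0ℚ ℚ.< η → Eventually (At η)
  eventually η 0<η = eventually-×
    {P = λ k → 0ℚ ℚ.+ (β ℚ.+ β) ℚ.≤ seq ε k × 1ℚ ℚ.≤ W k ℚ.+ ½}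
    {Q = λ k → (∀ ω → Light η ω k) × (∀ i → Selects i k)}
    (eventually-× ε-large (proj₂ (∑weight≈1 F) ½ 0<½))
    (eventually-× {P = λ k → ∀ ω → Light η ω k} {Q = λ k → ∀ i → Selects i k}
      (eventually-∀ {P = Light η} λ ω → weight≥0 F ω η 0<η)
      (eventually-∀ {P = Selects} selects-eventually))
  failsAt : ∀ {η} k → 0ℚ ℚ.< η → seeds F · η ℚ.≤ ½ ℚ.* (½ ℚ.* γ) → ¬ At η k
  failsAt k 0<η small ((ε≥2β , 1≤W+½) , 0≤w+η , bound) = no-gap {q ^ suc m} {q ^ m} {W k} 0<γ
    (ℚₚ.≤-trans (q^m≤q^n+p {m} 0≤p p≤1 np≡1) (ℚₚ.+-monoʳ-≤ (q ^ suc m) p≤γ))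
    1≤W+½ small
    (rivalFirst-bound {m} 0≤p p≤1 np≡1 F
      (+-nonNeg (^-nonNeg (≤⇒0≤- p≤1) (suc m)) (ℚₚ.<⇒≤ 0<β)) (ℚₚ.<⇒≤ 0<η) k
      0≤w+η x x≡p x>0
      (λ i → drop-slack {y = seq (y i) k} (q^n≤1/e {m} 0≤p p≤1 np≡1 k) ε≥2β (bound i)))
  fails : ¬ (∃[ η ] (0ℚ ℚ.< η × seeds F · η ℚ.≤ ½ ℚ.* (½ ℚ.* γ)))
  fails (η , 0<η , small) = eventually-fails (eventually η 0<η)
    where
    eventually-fails : ¬ Eventually (At η)
    eventually-fails (N , at) = failsAt {η} N 0<η small (at N ℕₚ.≤-refl)

theorem1p3 : (ε : ℝ) → 0ℝ < ε →
    ¬ (Σ[ A ∈ GreedyOCRS ]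
    ((n : ℕ) (x : 𝒫 n) (i : Fin n) (xᵢ>0 : 0ℝ < coord x i)
    (adv : Adversary (A n x)) →
    1/e + ε ≤ prSelectedGivenActive x (A n x) adv i xᵢ>0))
theorem1p3 ε (δ , 0<δ , ε≥δ) (A , good) =
  fails (unitFraction γ 0<γ)
  where
  -- `δ` is the rational margin by which `ε` exceeds 0; it is spent as four portions `γ`.
  γ : ℚ
  γ = ½ ℚ.* (½ ℚ.* δ)
  0<γ : 0ℚ ℚ.< γ
  0<γ = *-pos 0<½ (*-pos 0<½ 0<δ)
  4γ≡δ : (γ ℚ.+ γ) ℚ.+ (γ ℚ.+ γ) ≡ δ
  4γ≡δ = trans (cong₂ ℚ._+_ (½+½ (½ ℚ.* δ)) (½+½ (½ ℚ.* δ))) (½+½ δ)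
  fails : ¬ (∃[ m ] ∃[ p ] (0ℚ ℚ.< p × p ℚ.≤ γ × suc m · p ≡ 1ℚ))
  fails (m , p , 0<p , p≤γ , np≡1) = guarantee-fails {ε} 0<γ
    (subst (λ d → Eventually (λ k → 0ℚ ℚ.+ d ℚ.≤ seq ε k)) (sym 4γ≡δ) ε≥δ)
    0≤p p≤1 p≤γ np≡1 x refl x>0 (A (suc m) x)
    (λ i adv → good (suc m) x i (x>0 i) adv)
    where
    0≤p : 0ℚ ℚ.≤ p
    0≤p = ℚₚ.<⇒≤ 0<p
    p≤1 : p ℚ.≤ 1ℚ
    p≤1 = +-≤ {p} (·-nonNeg m 0≤p) np≡1
    x : 𝒫 (suc m)
    x = uniform (suc m) p 0≤p p≤1 np≡1
    x>0 : ∀ i → 0ℝ < coord x i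
    x>0 i = p , 0<p , 0 , λ _ _ → ℚₚ.≤-reflexive (ℚₚ.+-identityˡ p)
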